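{- For any integer $n\geq 1$, $$\sum_{k=0}^n\binom{k}{2}\left[{n \atop k}\right]_q (-1)^kq^{\binom{k}{2}}=(q ; q)_{n-1} \sum_{k=1}^{n-1} \frac{q^k}{1-q^k}.$$ In particular, $$\sum_{k=0}^{\infty}\binom{k}{2}\frac{(-1)^kq^{\binom{k}{2}}}{(q;q)_k}=(q ; q)_{\infty} \sum_{k=1}^{\infty} \frac{q^k}{1-q^k}.$$
   Context: $q$ is a complex number with $0<|q|<1$. $(a;q)_\infty=\prod_{j=0}^{\infty}(1-aq^j)$; for an integer $n\ge 0$, $(a;q)_n=\prod_{j=0}^{n-1}(1-aq^j)$; the $q$-binomial coefficient is $\left[{n\atop k}\right]_q=\frac{(q;q)_n}{(q;q)_k(q;q)_{n-k}}$. -}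

module Defs where

open import Algebra.Bundles.Raw using (RawRing)
import Algebra.Definitions.RawSemiring as RawSemiringDefinitions
open import Data.Fin.Base using (Fin; zero; suc; toℕ)
open import Data.Nat.Base as ℕ using (ℕ; zero; suc)
import Data.Nat.Properties as ℕ
open import Data.Product.Base using (∃; _×_; _,_)
open import Data.Rational.Base as ℚ using (ℚ; 0ℚ; 1ℚ; ½)
import Data.Rational.Properties as ℚ
open import Data.Rational.Solver using (module +-*-Solver)
open import Data.Sum.Base using (inj₁; inj₂)
open import Level using (0ℓ)
open import Relation.Binary.PropositionalEquality
  using (_≡_; refl; sym; trans; cong; subst; subst₂)
open import Relation.Nullary using (yes; no; contradiction)

open +-*-Solver using (solve; _:=_; _:+_; _:*_; _:-_; :-_; con)

+-pos : ∀ {p q} → 0ℚ ℚ.< p → 0ℚ ℚ.< q → 0ℚ ℚ.< p ℚ.+ q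
+-pos 0<p 0<q = ℚ.+-mono-< 0<p 0<q

*-pos : ∀ {p q} → 0ℚ ℚ.< p → 0ℚ ℚ.< q → 0ℚ ℚ.< p ℚ.* q
*-pos {p} {q} 0<p 0<q = ℚ.positive⁻¹ (p ℚ.* q)
  {{ℚ.pos*pos⇒pos p {{ℚ.positive 0<p}} q {{ℚ.positive 0<q}}}}

square-nonneg : ∀ p → 0ℚ ℚ.≤ p ℚ.* p
square-nonneg p with ℚ.≤-total 0ℚ p
... | inj₁ 0≤p = ℚ.nonNegative⁻¹ (p ℚ.* p)
  {{ℚ.nonNeg*nonNeg⇒nonNeg p {{ℚ.nonNegative 0≤p}} p {{ℚ.nonNegative 0≤p}}}}
... | inj₂ p≤0 = ℚ.nonNegative⁻¹ (p ℚ.* p)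
  {{ℚ.nonPos*nonPos⇒nonPos p {{ℚ.nonPositive p≤0}} p {{ℚ.nonPositive p≤0}}}}

*-mono-< : ∀ {a b c d} → 0ℚ ℚ.≤ a → 0ℚ ℚ.≤ b → a ℚ.< c → b ℚ.< d →
           a ℚ.* b ℚ.< c ℚ.* d
*-mono-< {a} {b} {c} {d} 0≤a 0≤b a<c b<d = ℚ.≤-<-trans
  (ℚ.*-monoʳ-≤-nonNeg b {{ℚ.nonNegative 0≤b}} (ℚ.<⇒≤ a<c))
  (ℚ.*-monoʳ-<-pos c {{ℚ.positive (ℚ.≤-<-trans 0≤a a<c)}} b<d)

-- The reciprocal, with the junk value 0 at 0.
recip : ℚ → ℚ
recip p with p ℚ.≟ 0ℚ
... | yes _  = 0ℚ
... | no p≢0 = ℚ.1/_ p {{ℚ.≢-nonZero p≢0}}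

recip-inverse : ∀ {p} → 0ℚ ℚ.< p → p ℚ.* recip p ≡ 1ℚ
recip-inverse {p} 0<p with p ℚ.≟ 0ℚ
... | yes p≡0 = contradiction (sym p≡0) (ℚ.<⇒≢ 0<p)
... | no p≢0  = ℚ.*-inverseʳ p {{ℚ.≢-nonZero p≢0}}

recip-pos : ∀ {p} → 0ℚ ℚ.< p → 0ℚ ℚ.< recip p
recip-pos {p} 0<p = ℚ.*-cancelˡ-<-nonNeg p {{ℚ.nonNegative (ℚ.<⇒≤ 0<p)}}
  (subst₂ ℚ._<_ (sym (ℚ.*-zeroʳ p)) (sym (recip-inverse 0<p))
    (ℚ.positive⁻¹ 1ℚ))

Eventually : (ℕ → Set) → Set
Eventually P = ∃ λ N → ∀ n → N ℕ.≤ n → P n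

IsCauchy : (ℕ → ℚ) → Set
IsCauchy s = ∀ ε → 0ℚ ℚ.< ε →
  ∃ λ N → ∀ m n → N ℕ.≤ m → N ℕ.≤ n → ℚ.∣ s m ℚ.- s n ∣ ℚ.< ε

-- The Cauchy reals: the modulus of convergence is part of the data (∃ is Σ),
-- and equality is _≈ᵣ_, i.e. the difference is a null sequence.
record ℝ : Set where
  no-eta-equality
  constructor mkℝ
  field
    seq    : ℕ → ℚ
    cauchy : IsCauchy seq

open ℝ public

infix 4 _≈ᵣ_ _<ᵣ_

_≈ᵣ_ : ℝ → ℝ → Set
x ≈ᵣ y = ∀ ε → 0ℚ ℚ.< ε → Eventually λ n → ℚ.∣ seq x n ℚ.- seq y n ∣ ℚ.< ε

-- The gap δ has to be uniform: a termwise strict inequality would not be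
-- stable under ≈ᵣ.
_<ᵣ_ : ℝ → ℝ → Set
x <ᵣ y = ∃ λ δ → 0ℚ ℚ.< δ × Eventually λ n → seq x n ℚ.+ δ ℚ.< seq y n

both : ∀ {P Q R : ℕ → Set} → (∀ {n} → P n → Q n → R n) →
       Eventually P → Eventually Q → Eventually R
both f (M , p) (N , q) = M ℕ.⊔ N , λ n M⊔N≤n →
  f (p n (ℕ.≤-trans (ℕ.m≤m⊔n M N) M⊔N≤n))
    (q n (ℕ.≤-trans (ℕ.m≤n⊔m M N) M⊔N≤n))

eventually-bounded : ∀ {s} → IsCauchy s →
  ∃ λ B → 0ℚ ℚ.< B × Eventually λ n → ℚ.∣ s n ∣ ℚ.< B
eventually-bounded {s} s-cauchy with s-cauchy 1ℚ (ℚ.positive⁻¹ 1ℚ)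
... | N , close = 1ℚ ℚ.+ ℚ.∣ s N ∣
  , ℚ.+-mono-<-≤ (ℚ.positive⁻¹ 1ℚ) (ℚ.0≤∣p∣ (s N))
  , N , λ n N≤n → ℚ.≤-<-trans
      (subst (λ t → ℚ.∣ t ∣ ℚ.≤ ℚ.∣ s n ℚ.- s N ∣ ℚ.+ ℚ.∣ s N ∣)
        (solve 2 (λ a b → a :- b :+ b := a) refl (s n) (s N))
        (ℚ.∣p+q∣≤∣p∣+∣q∣ (s n ℚ.- s N) (s N)))
      (ℚ.+-monoˡ-< ℚ.∣ s N ∣ (close n N N≤n ℕ.≤-refl))

fromℚ : ℚ → ℝ
fromℚ p = mkℝ (λ _ → p) λ ε 0<ε →
  0 , λ _ _ _ _ → subst (λ t → ℚ.∣ t ∣ ℚ.< ε) (sym (ℚ.+-inverseʳ p)) 0<ε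

0ᵣ 1ᵣ : ℝ
0ᵣ = fromℚ 0ℚ
1ᵣ = fromℚ 1ℚ

infixl 6 _+ᵣ_
infixl 7 _*ᵣ_
infix  8 -ᵣ_

_+ᵣ_ : ℝ → ℝ → ℝ
seq (x +ᵣ y) n = seq x n ℚ.+ seq y n
cauchy (x +ᵣ y) ε 0<ε =
  let s = seq x
      t = seq y
      0<ε/2 = *-pos (ℚ.positive⁻¹ ½) 0<ε
      M , p = cauchy x (½ ℚ.* ε) 0<ε/2
      N , q = cauchy y (½ ℚ.* ε) 0<ε/2
  in M ℕ.⊔ N , λ m n m≥ n≥ → subst (_ ℚ.<_)
    (solve 1 (λ e → con ½ :* e :+ con ½ :* e := e) refl ε)
    (ℚ.≤-<-trans
      (subst (λ u → ℚ.∣ u ∣ ℚ.≤ ℚ.∣ s m ℚ.- s n ∣ ℚ.+ ℚ.∣ t m ℚ.- t n ∣)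
        (solve 4 (λ a b c d → (a :- b) :+ (c :- d) := (a :+ c) :- (b :+ d))
          refl (s m) (s n) (t m) (t n))
        (ℚ.∣p+q∣≤∣p∣+∣q∣ (s m ℚ.- s n) (t m ℚ.- t n)))
      (ℚ.+-mono-<
        (p m n (ℕ.≤-trans (ℕ.m≤m⊔n M N) m≥) (ℕ.≤-trans (ℕ.m≤m⊔n M N) n≥))
        (q m n (ℕ.≤-trans (ℕ.m≤n⊔m M N) m≥) (ℕ.≤-trans (ℕ.m≤n⊔m M N) n≥))))

-ᵣ_ : ℝ → ℝ
seq (-ᵣ x) n = ℚ.- seq x n
cauchy (-ᵣ x) ε 0<ε =
  let s = seq x
      N , p = cauchy x ε 0<ε
  in N , λ m n m≥ n≥ → subst (ℚ._< ε)
    (trans (sym (ℚ.∣-p∣≡∣p∣ (s m ℚ.- s n)))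
      (cong ℚ.∣_∣
        (solve 2 (λ a b → :- (a :- b) := :- a :- :- b) refl (s m) (s n))))
    (p m n m≥ n≥)

_*ᵣ_ : ℝ → ℝ → ℝ
seq (x *ᵣ y) n = seq x n ℚ.* seq y n
cauchy (x *ᵣ y) ε 0<ε =
  let s = seq x
      t = seq y
      A , 0<A , K , s<A = eventually-bounded (cauchy x)
      B , 0<B , L , t<B = eventually-bounded (cauchy y)
      0<A+B = +-pos 0<A 0<B
      δ = recip (A ℚ.+ B) ℚ.* ε
      0<δ = *-pos (recip-pos 0<A+B) 0<ε
      M , p = cauchy x δ 0<δ
      N , q = cauchy y δ 0<δ
      J = (K ℕ.⊔ L) ℕ.⊔ (M ℕ.⊔ N)
      K≤J = ℕ.≤-trans (ℕ.m≤m⊔n K L) (ℕ.m≤m⊔n (K ℕ.⊔ L) (M ℕ.⊔ N))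
      L≤J = ℕ.≤-trans (ℕ.m≤n⊔m K L) (ℕ.m≤m⊔n (K ℕ.⊔ L) (M ℕ.⊔ N))
      M≤J = ℕ.≤-trans (ℕ.m≤m⊔n M N) (ℕ.m≤n⊔m (K ℕ.⊔ L) (M ℕ.⊔ N))
      N≤J = ℕ.≤-trans (ℕ.m≤n⊔m M N) (ℕ.m≤n⊔m (K ℕ.⊔ L) (M ℕ.⊔ N))
      Aδ+Bδ≡ε = trans
        (solve 4 (λ a b r e → a :* (r :* e) :+ b :* (r :* e) := (a :+ b) :* r :* e)
          refl A B (recip (A ℚ.+ B)) ε)
        (trans (cong (ℚ._* ε) (recip-inverse 0<A+B)) (ℚ.*-identityˡ ε))
  in J , λ m n m≥ n≥ → subst₂ ℚ._<_
    (cong ℚ.∣_∣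
      (solve 4 (λ a b c d → a :* (c :- d) :+ d :* (a :- b) := a :* c :- b :* d)
        refl (s m) (s n) (t m) (t n)))
    Aδ+Bδ≡ε
    (ℚ.≤-<-trans
      (ℚ.∣p+q∣≤∣p∣+∣q∣ (s m ℚ.* (t m ℚ.- t n)) (t n ℚ.* (s m ℚ.- s n)))
      (ℚ.+-mono-<
        (subst (ℚ._< A ℚ.* δ) (sym (ℚ.∣p*q∣≡∣p∣*∣q∣ (s m) (t m ℚ.- t n)))
          (*-mono-< (ℚ.0≤∣p∣ (s m)) (ℚ.0≤∣p∣ (t m ℚ.- t n))
            (s<A m (ℕ.≤-trans K≤J m≥))
            (q m n (ℕ.≤-trans N≤J m≥) (ℕ.≤-trans N≤J n≥))))
        (subst (ℚ._< B ℚ.* δ) (sym (ℚ.∣p*q∣≡∣p∣*∣q∣ (t n) (s m ℚ.- s n)))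
          (*-mono-< (ℚ.0≤∣p∣ (t n)) (ℚ.0≤∣p∣ (s m ℚ.- s n))
            (t<B n (ℕ.≤-trans L≤J n≥))
            (p m n (ℕ.≤-trans M≤J m≥) (ℕ.≤-trans M≤J n≥))))))

-- The sequence does not depend on the proof of positivity; that is only
-- used to see that it is Cauchy.
inverseᵣ : (x : ℝ) → 0ᵣ <ᵣ x → ℝ
seq (inverseᵣ x _) n = recip (seq x n)
cauchy (inverseᵣ x (δ , 0<δ , M , δ<s)) ε 0<ε =
  let s = seq x
      N , p = cauchy x (ε ℚ.* (δ ℚ.* δ)) (*-pos 0<ε (*-pos 0<δ 0<δ))
      M≤ : ∀ {k} → M ℕ.⊔ N ℕ.≤ k → M ℕ.≤ k
      M≤ = ℕ.≤-trans (ℕ.m≤m⊔n M N)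
      N≤ : ∀ {k} → M ℕ.⊔ N ℕ.≤ k → N ℕ.≤ k
      N≤ = ℕ.≤-trans (ℕ.m≤n⊔m M N)
  in M ℕ.⊔ N , λ m n m≥ n≥ →
    let a = s m
        b = s n
        δ<a = subst (ℚ._< a) (ℚ.+-identityˡ δ) (δ<s m (M≤ m≥))
        δ<b = subst (ℚ._< b) (ℚ.+-identityˡ δ) (δ<s n (M≤ n≥))
        0<a = ℚ.<-trans 0<δ δ<a
        0<b = ℚ.<-trans 0<δ δ<b
        0<ab = *-pos 0<a 0<b
        ab≡∣ab∣ = sym (ℚ.0≤p⇒∣p∣≡p (ℚ.<⇒≤ 0<ab))
        difference = trans
          (solve 4 (λ a b i j → (i :- j) :* (a :* b) := b :* (a :* i) :- a :* (b :* j))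
            refl a b (recip a) (recip b))
          (trans
            (cong (λ u → b ℚ.* u ℚ.- a ℚ.* (b ℚ.* recip b)) (recip-inverse 0<a))
            (trans
              (cong (λ u → b ℚ.* 1ℚ ℚ.- a ℚ.* u) (recip-inverse 0<b))
              (solve 2 (λ a b → b :* con 1ℚ :- a :* con 1ℚ := :- (a :- b))
                refl a b)))
        scaled = trans (cong (ℚ.∣ recip a ℚ.- recip b ∣ ℚ.*_) ab≡∣ab∣)
          (trans (sym (ℚ.∣p*q∣≡∣p∣*∣q∣ (recip a ℚ.- recip b) (a ℚ.* b)))
            (trans (cong ℚ.∣_∣ difference) (ℚ.∣-p∣≡∣p∣ (a ℚ.- b))))
    in ℚ.*-cancelʳ-<-nonNeg (a ℚ.* b) {{ℚ.nonNegative (ℚ.<⇒≤ 0<ab)}}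
      (subst (ℚ._< ε ℚ.* (a ℚ.* b)) (sym scaled)
        (ℚ.<-trans (p m n (N≤ m≥) (N≤ n≥))
          (ℚ.*-monoʳ-<-pos ε {{ℚ.positive 0<ε}}
            (*-mono-< (ℚ.<⇒≤ 0<δ) (ℚ.<⇒≤ 0<δ) δ<a δ<b))))

infix 5 _+i_

record ℂ : Set where
  no-eta-equality
  constructor _+i_
  field
    re im : ℝ

open ℂ public

infix  4 _≈_
infixl 6 _+_
infixl 7 _*_
infix  8 -_

_≈_ : ℂ → ℂ → Set
z ≈ w = re z ≈ᵣ re w × im z ≈ᵣ im w

0# 1# : ℂ
0# = 0ᵣ +i 0ᵣ
1# = 1ᵣ +i 0ᵣ

_+_ : ℂ → ℂ → ℂ
re (z + w) = re z +ᵣ re w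
im (z + w) = im z +ᵣ im w

-_ : ℂ → ℂ
re (- z) = -ᵣ re z
im (- z) = -ᵣ im z

_*_ : ℂ → ℂ → ℂ
re (z * w) = re z *ᵣ re w +ᵣ -ᵣ (im z *ᵣ im w)
im (z * w) = re z *ᵣ im w +ᵣ im z *ᵣ re w

ℂ-rawRing : RawRing 0ℓ 0ℓ
ℂ-rawRing = record
  { Carrier = ℂ
  ; _≈_ = _≈_ ; _+_ = _+_ ; _*_ = _*_ ; -_ = -_ ; 0# = 0# ; 1# = 1#
  }

open RawSemiringDefinitions (RawRing.rawSemiring ℂ-rawRing) public
  using (_^_; sum; product)
  renaming (_×_ to _·_)   -- n · z = z + ⋯ + z, for n : ℕ

infixl 6 _-_
_-_ : ℂ → ℂ → ℂ
z - w = z + (- w)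

∣_∣² : ℂ → ℝ
∣ z ∣² = re z *ᵣ re z +ᵣ im z *ᵣ im z

-- Comparisons of the modulus |z| = √(re² + im²) with a real number, written
-- without the square root; the first component of ∣ z ∣< r is needed because
-- squaring is only monotone on nonnegative reals.
infix 4 0<∣_∣ ∣_∣<_

0<∣_∣ : ℂ → Set
0<∣ z ∣ = 0ᵣ <ᵣ ∣ z ∣²

∣_∣<_ : ℂ → ℝ → Set
∣ z ∣< r = 0ᵣ <ᵣ r × ∣ z ∣² <ᵣ r *ᵣ r

-- z / w = z · w̄ / |w|².  A nonzero divisor is one of positive modulus:
-- constructively, ¬ (w ≈ 0#) would not be enough.
infixl 7 _/_[_]
_/_[_] : ℂ → (w : ℂ) → 0<∣ w ∣ → ℂ
z / w [ 0<∣w∣ ] = z * (re w *ᵣ r +i -ᵣ (im w *ᵣ r))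
  where r = inverseᵣ ∣ w ∣² 0<∣w∣

infix 4 _⟶_
_⟶_ : (ℕ → ℂ) → ℂ → Set
s ⟶ l = ∀ ε → 0ᵣ <ᵣ ε → Eventually λ n → ∣ s n - l ∣< ε

∑< : ℕ → (ℕ → ℂ) → ℂ
∑< n f = sum {n} λ k → f (toℕ k)

syntax ∑< n (λ k → t) = ∑[ k < n ] t

∏< : ℕ → (ℕ → ℂ) → ℂ
∏< n f = product {n} λ k → f (toℕ k)

syntax ∏< n (λ k → t) = ∏[ k < n ] t

-- ∑_{k=0}^∞ f(k) converges, with sum l.
∑∞_≡_ : (ℕ → ℂ) → ℂ → Set
∑∞ f ≡ l = (λ n → ∑< n f) ⟶ l

∏∞_≡_ : (ℕ → ℂ) → ℂ → Set
∏∞ f ≡ l = (λ n → ∏< n f) ⟶ l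

∣zw∣² : ∀ z w n → seq ∣ z * w ∣² n ≡ seq ∣ z ∣² n ℚ.* seq ∣ w ∣² n
∣zw∣² z w n =
  solve 4 (λ a b c d →
      (a :* c :+ :- (b :* d)) :* (a :* c :+ :- (b :* d))
        :+ (a :* d :+ b :* c) :* (a :* d :+ b :* c)
      := (a :* a :+ b :* b) :* (c :* c :+ d :* d))
    refl (seq (re z) n) (seq (im z) n) (seq (re w) n) (seq (im w) n)

0≤∣z∣² : ∀ z n → 0ℚ ℚ.≤ seq ∣ z ∣² n
0≤∣z∣² z n =
  ℚ.+-mono-≤ (square-nonneg (seq (re z) n)) (square-nonneg (seq (im z) n))

0<∣1∣ : 0<∣ 1# ∣
0<∣1∣ = ½ , ℚ.positive⁻¹ ½ , 0 , λ _ _ → ℚ.*<* (ℤ.+<+ (ℕ.s≤s (ℕ.s≤s ℕ.z≤n)))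
  where import Data.Integer.Base as ℤ

half-< : ∀ {δ u} → δ ℚ.< u ℚ.+ u → ½ ℚ.* δ ℚ.< u
half-< {δ} {u} δ<2u =
  subst (½ ℚ.* δ ℚ.<_) (solve 1 (λ u → con ½ :* (u :+ u) := u) refl u)
    (ℚ.*-monoʳ-<-pos ½ δ<2u)

0<∣zw∣ : ∀ z w → 0<∣ z ∣ → 0<∣ w ∣ → 0<∣ z * w ∣
0<∣zw∣ z w (δ , 0<δ , p) (η , 0<η , q) =
  δ ℚ.* η , *-pos 0<δ 0<η ,
  both (λ {n} δ<z η<w → subst₂ ℚ._<_
      (sym (ℚ.+-identityˡ (δ ℚ.* η))) (sym (∣zw∣² z w n))
      (*-mono-< (ℚ.<⇒≤ 0<δ) (ℚ.<⇒≤ 0<η)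
        (subst (ℚ._< seq ∣ z ∣² n) (ℚ.+-identityˡ δ) δ<z)
        (subst (ℚ._< seq ∣ w ∣² n) (ℚ.+-identityˡ η) η<w)))
    p q

0<∣∏∣ : ∀ {n} (f : Fin n → ℂ) → (∀ k → 0<∣ f k ∣) → 0<∣ product f ∣
0<∣∏∣ {zero}  f 0<∣f∣ = 0<∣1∣
0<∣∏∣ {suc n} f 0<∣f∣ = 0<∣zw∣ (f zero) (product λ k → f (suc k)) (0<∣f∣ zero)
  (0<∣∏∣ (λ k → f (suc k)) λ k → 0<∣f∣ (suc k))

0<∣1-z∣ : ∀ z → ∣ z ∣< 1ᵣ → 0<∣ 1# - z ∣
0<∣1-z∣ z (_ , δ , 0<δ , N , p) =
  ½ ℚ.* δ ℚ.* (½ ℚ.* δ) , *-pos 0<δ/2 0<δ/2 , N , λ n n≥ →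
  let x = seq (re z) n
      y = seq (im z) n
      u = 1ℚ ℚ.+ ℚ.- x
      v = 0ℚ ℚ.+ ℚ.- y
      ∣z∣²≥ : 1ℚ ℚ.- (u ℚ.+ u) ℚ.≤ seq ∣ z ∣² n
      ∣z∣²≥ = subst₂ ℚ._≤_ (ℚ.+-identityʳ (1ℚ ℚ.- (u ℚ.+ u)))
        (solve 2 (λ x y → (con 1ℚ :- ((con 1ℚ :+ :- x) :+ (con 1ℚ :+ :- x)))
                       :+ ((con 1ℚ :+ :- x) :* (con 1ℚ :+ :- x) :+ y :* y)
                     := x :* x :+ y :* y) refl x y)
        (ℚ.+-monoʳ-≤ (1ℚ ℚ.- (u ℚ.+ u))
          (ℚ.+-mono-≤ (square-nonneg u) (square-nonneg y)))
      δ<2u : δ ℚ.< u ℚ.+ u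
      δ<2u = subst₂ ℚ._<_
        (solve 2 (λ d u → (con 1ℚ :- (u :+ u)) :+ d :+ ((u :+ u) :- con 1ℚ) := d)
          refl δ u)
        (solve 1 (λ u → con 1ℚ :+ ((u :+ u) :- con 1ℚ) := u :+ u) refl u)
        (ℚ.+-monoˡ-< ((u ℚ.+ u) ℚ.- 1ℚ)
          (ℚ.≤-<-trans (ℚ.+-monoˡ-≤ δ ∣z∣²≥) (p n n≥)))
      δ/2<u : ½ ℚ.* δ ℚ.< u
      δ/2<u = half-< {δ} {u} δ<2u
  in subst (ℚ._< u ℚ.* u ℚ.+ v ℚ.* v)
       (ℚ.+-comm (½ ℚ.* δ ℚ.* (½ ℚ.* δ)) 0ℚ)
       (ℚ.+-mono-<-≤
         (*-mono-< {c = u} {d = u} (ℚ.<⇒≤ 0<δ/2) (ℚ.<⇒≤ 0<δ/2) δ/2<u δ/2<u)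
         (square-nonneg v))
  where 0<δ/2 = *-pos (ℚ.positive⁻¹ ½) 0<δ

∣qz∣²≤∣q∣² : ∀ q z n → seq ∣ z ∣² n ℚ.≤ 1ℚ → seq ∣ q * z ∣² n ℚ.≤ seq ∣ q ∣² n
∣qz∣²≤∣q∣² q z n ∣z∣²≤1 = subst₂ ℚ._≤_
  (sym (∣zw∣² q z n)) (ℚ.*-identityʳ (seq ∣ q ∣² n))
  (ℚ.*-monoˡ-≤-nonNeg (seq ∣ q ∣² n) {{ℚ.nonNegative (0≤∣z∣² q n)}} ∣z∣²≤1)

∣q^k∣²≤1 : ∀ q → ∣ q ∣< 1ᵣ → ∀ k → Eventually λ n → seq ∣ q ^ k ∣² n ℚ.≤ 1ℚ
∣q^k∣²≤1 q ∣q∣<1 zero = 0 , λ _ _ → ℚ.≤-refl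
∣q^k∣²≤1 q ∣q∣<1@(_ , δ , 0<δ , p) (suc k) =
  both (λ {n} ∣q∣²+δ<1 ∣q^k∣²≤1 → ℚ.≤-trans (∣qz∣²≤∣q∣² q (q ^ k) n ∣q^k∣²≤1)
      (ℚ.<⇒≤ (ℚ.≤-<-trans
        (subst (ℚ._≤ seq ∣ q ∣² n ℚ.+ δ) (ℚ.+-identityʳ (seq ∣ q ∣² n))
          (ℚ.+-monoʳ-≤ (seq ∣ q ∣² n) (ℚ.<⇒≤ 0<δ)))
        ∣q∣²+δ<1)))
    p (∣q^k∣²≤1 q ∣q∣<1 k)

∣q^k∣<1 : ∀ q → ∣ q ∣< 1ᵣ → ∀ k → ∣ q ^ suc k ∣< 1ᵣ
∣q^k∣<1 q ∣q∣<1@(0<1 , δ , 0<δ , p) k = 0<1 , δ , 0<δ ,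
  both (λ {n} ∣q∣²+δ<1 ∣q^k∣²≤1 → ℚ.≤-<-trans
      (ℚ.+-monoˡ-≤ δ (∣qz∣²≤∣q∣² q (q ^ k) n ∣q^k∣²≤1)) ∣q∣²+δ<1)
    p (∣q^k∣²≤1 q ∣q∣<1 k)

0<∣1-q^1+k∣ : ∀ q k → ∣ q ∣< 1ᵣ → 0<∣ 1# - q ^ suc k ∣
0<∣1-q^1+k∣ q k ∣q∣<1 = 0<∣1-z∣ (q ^ suc k) (∣q^k∣<1 q ∣q∣<1 k)

-- (a;q)_n
⟨_⨾_⟩_ : ℂ → ℂ → ℕ → ℂ
⟨ a ⨾ q ⟩ n = ∏[ j < n ] (1# - a * q ^ j)

-- (a;q)_∞ converges, with value l.
⟨_⨾_⟩∞≡_ : ℂ → ℂ → ℂ → Set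
⟨ a ⨾ q ⟩∞≡ l = ∏∞ (λ j → 1# - a * q ^ j) ≡ l

0<∣⟨q⨾q⟩∣ : ∀ q n → ∣ q ∣< 1ᵣ → 0<∣ ⟨ q ⨾ q ⟩ n ∣
0<∣⟨q⨾q⟩∣ q n ∣q∣<1 =
  0<∣∏∣ {n} (λ j → 1# - q * q ^ toℕ j) λ j → 0<∣1-q^1+k∣ q (toℕ j) ∣q∣<1

-- Meaningful for k ≤ n only: the subtraction n ∸ k is truncated.
qBinomial : (q : ℂ) → ∣ q ∣< 1ᵣ → ℕ → ℕ → ℂ
qBinomial q ∣q∣<1 n k =
  ⟨ q ⨾ q ⟩ n / ⟨ q ⨾ q ⟩ k * ⟨ q ⨾ q ⟩ (n ℕ.∸ k)
    [ 0<∣zw∣ (⟨ q ⨾ q ⟩ k) (⟨ q ⨾ q ⟩ (n ℕ.∸ k))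
        (0<∣⟨q⨾q⟩∣ q k ∣q∣<1) (0<∣⟨q⨾q⟩∣ q (n ℕ.∸ k) ∣q∣<1) ]

{-# OPTIONS --safe #-}
-- Let c(n,k) be the coefficient of x^k in ∏_{j<n} (1 - x q^j), which is
-- (-1)^k q^{k choose 2} times the q-binomial coefficient. From
-- c(n+1,k+1) = c(n,k+1) - q^n c(n,k), the moments of k ↦ c(n,k) satisfy
-- L_{n+1}(f) = L_n(f) - q^n L_n(f(· + 1)). For f = 1, k and (k choose 2) this
-- gives in turn 0, -(q;q)_{n-1} and (q;q)_{n-1} ∑_{0<k<n} q^k/(1-q^k), for n ≥ 1.
--
-- For the limit, let e(k) = (-1)^k q^{k choose 2}/(q;q)_k. The recursions of c(n,k)
-- and e(k) in k show that c(n,k) is bounded and that |e(k) - c(n,k)| = O(|q|^n)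
-- uniformly in k ≤ n; hence the partial sums of the series differ from
-- (q;q)_n ∑_{k≤n} q^k/(1-q^k) by O(n³|q|^n). Since moment number one is
-- -(q;q)_{n-1}, boundedness of c also gives (q;q)_n = O(n²), enough for convergence.
--
-- All of this is proved for Gaussian rationals q, with bounds depending only on a
-- bound on |q|, and applied to the rational approximations of a complex q; the
-- limits are then read off along the diagonal.
module Submission where

open import Defs
open import Algebra.Bundles using (CommutativeRing; Monoid; Semiring)
import Algebra.Definitions.RawSemiring as RawSemiringDefinitions
import Algebra.Properties.CommutativeMonoid.Sum as CommutativeMonoidSum
import Algebra.Properties.Monoid.Mult as MonoidMult
import Algebra.Properties.Monoid.Sum as MonoidSum
import Algebra.Properties.Semiring.Sum as SemiringSum
import Algebra.Solver.Ring.AlmostCommutativeRing as ACR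
import Algebra.Solver.Ring.Simple as RingSolver
open import Data.Empty using (⊥-elim)
open import Data.Fin.Base using (toℕ)
open import Data.Fin.Properties using (toℕ<n)
open import Data.Integer.Base as ℤ using (+_; -[1+_])
import Data.Integer.Properties as ℤ
open import Data.Nat.Base as ℕ using (ℕ; zero; suc; _∸_; _≤_; s≤s; z≤n)
open import Data.Nat.Combinatorics using (_C_; nC1≡n; nCk+nC[k+1]≡[n+1]C[k+1])
import Data.Nat.Properties as ℕ
open import Data.Product.Base using (_×_; _,_; proj₁; proj₂; ∃; ∃-syntax)
open import Data.Rational.Base as ℚ using (ℚ; 0ℚ; 1ℚ; ½; mkℚ)
import Data.Rational.Properties as ℚ
open import Data.Rational.Solver using (module +-*-Solver)
import Data.Rational.Unnormalised.Base as ℚᵘ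
import Data.Rational.Unnormalised.Properties as ℚᵘ
open import Data.Sum.Base using (inj₁; inj₂)
open import Level using (0ℓ)
open import Relation.Binary.PropositionalEquality
  using (_≡_; refl; sym; trans; cong; cong₂; subst; subst₂; isEquivalence; module ≡-Reasoning)
open import Relation.Nullary using (Dec; yes; no)
open import Relation.Nullary.Decidable using (map′; _×-dec_)

open +-*-Solver using (solve; _:=_; _:+_; _:*_; _:-_; :-_; con)

-- Gaussian rationals

infixl 6 _+ᵍ_
infixl 7 _*ᵍ_
infix  8 -ᵍ_

-- Without η the ring operations stay folded on variables, which keeps unification
-- from descending to the rational components.
record 𝔾 : Set where
  no-eta-equality
  pattern
  constructor _+𝕚_
  field
    reᵍ imᵍ : ℚ

open 𝔾

0ᵍ 1ᵍ : 𝔾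
0ᵍ = 0ℚ +𝕚 0ℚ
1ᵍ = 1ℚ +𝕚 0ℚ

_+ᵍ_ _*ᵍ_ : 𝔾 → 𝔾 → 𝔾
(a +𝕚 b) +ᵍ (c +𝕚 d) = (a ℚ.+ c) +𝕚 (b ℚ.+ d)
(a +𝕚 b) *ᵍ (c +𝕚 d) = (a ℚ.* c ℚ.+ ℚ.- (b ℚ.* d)) +𝕚 (a ℚ.* d ℚ.+ b ℚ.* c)

-ᵍ_ : 𝔾 → 𝔾
-ᵍ (a +𝕚 b) = (ℚ.- a) +𝕚 (ℚ.- b)

_≟ᵍ_ : (z w : 𝔾) → Dec (z ≡ w)
(a +𝕚 b) ≟ᵍ (c +𝕚 d) =
  map′ (λ (p , q) → cong₂ _+𝕚_ p q) (λ p → cong reᵍ p , cong imᵍ p) ((a ℚ.≟ c) ×-dec (b ℚ.≟ d))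

𝔾-commutativeRing : CommutativeRing 0ℓ 0ℓ
𝔾-commutativeRing = record
  { Carrier = 𝔾 ; _≈_ = _≡_ ; _+_ = _+ᵍ_ ; _*_ = _*ᵍ_ ; -_ = -ᵍ_ ; 0# = 0ᵍ ; 1# = 1ᵍ
  ; isCommutativeRing = record
    { isRing = record
      { +-isAbelianGroup = record
        { isGroup = record
          { isMonoid = record
            { isSemigroup = record
              { isMagma = record { isEquivalence = isEquivalence ; ∙-cong = cong₂ _+ᵍ_ }
              ; assoc = (λ { (a +𝕚 b) (c +𝕚 d) (e +𝕚 f) →
                  cong₂ _+𝕚_ (ℚ.+-assoc a c e) (ℚ.+-assoc b d f) })
              }
            ; identity =
                (λ { (a +𝕚 b) → cong₂ _+𝕚_ (ℚ.+-identityˡ a) (ℚ.+-identityˡ b) })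
              , (λ { (a +𝕚 b) → cong₂ _+𝕚_ (ℚ.+-identityʳ a) (ℚ.+-identityʳ b) })
            }
          ; inverse =
              (λ { (a +𝕚 b) → cong₂ _+𝕚_ (ℚ.+-inverseˡ a) (ℚ.+-inverseˡ b) })
            , (λ { (a +𝕚 b) → cong₂ _+𝕚_ (ℚ.+-inverseʳ a) (ℚ.+-inverseʳ b) })
          ; ⁻¹-cong = cong -ᵍ_
          }
        ; comm = (λ { (a +𝕚 b) (c +𝕚 d) → cong₂ _+𝕚_ (ℚ.+-comm a c) (ℚ.+-comm b d) })
        }
      ; *-cong = cong₂ _*ᵍ_
      ; *-assoc = (λ { (a +𝕚 b) (c +𝕚 d) (e +𝕚 f) → cong₂ _+𝕚_
          (solve 6 (λ a b c d e f →
            (a :* c :+ :- (b :* d)) :* e :+ :- ((a :* d :+ b :* c) :* f)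
            := a :* (c :* e :+ :- (d :* f)) :+ :- (b :* (c :* f :+ d :* e)))
            refl a b c d e f)
          (solve 6 (λ a b c d e f →
            (a :* c :+ :- (b :* d)) :* f :+ (a :* d :+ b :* c) :* e
            := a :* (c :* f :+ d :* e) :+ b :* (c :* e :+ :- (d :* f)))
            refl a b c d e f) })
      ; *-identity =
          (λ { (a +𝕚 b) → cong₂ _+𝕚_
            (solve 2 (λ a b → con 1ℚ :* a :+ :- (con 0ℚ :* b) := a) refl a b)
            (solve 2 (λ a b → con 1ℚ :* b :+ con 0ℚ :* a := b) refl a b) })
        , (λ { (a +𝕚 b) → cong₂ _+𝕚_
            (solve 2 (λ a b → a :* con 1ℚ :+ :- (b :* con 0ℚ) := a) refl a b)
            (solve 2 (λ a b → a :* con 0ℚ :+ b :* con 1ℚ := b) refl a b) })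
      ; distrib =
          (λ { (a +𝕚 b) (c +𝕚 d) (e +𝕚 f) → cong₂ _+𝕚_
            (solve 6 (λ a b c d e f →
              a :* (c :+ e) :+ :- (b :* (d :+ f))
              := (a :* c :+ :- (b :* d)) :+ (a :* e :+ :- (b :* f)))
              refl a b c d e f)
            (solve 6 (λ a b c d e f →
              a :* (d :+ f) :+ b :* (c :+ e)
              := (a :* d :+ b :* c) :+ (a :* f :+ b :* e))
              refl a b c d e f) })
        , (λ { (a +𝕚 b) (c +𝕚 d) (e +𝕚 f) → cong₂ _+𝕚_
            (solve 6 (λ a b c d e f →
              (c :+ e) :* a :+ :- ((d :+ f) :* b)
              := (c :* a :+ :- (d :* b)) :+ (e :* a :+ :- (f :* b)))
              refl a b c d e f)
            (solve 6 (λ a b c d e f →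
              (c :+ e) :* b :+ (d :+ f) :* a
              := (c :* b :+ d :* a) :+ (e :* b :+ f :* a))
              refl a b c d e f) })
      }
    ; *-comm = (λ { (a +𝕚 b) (c +𝕚 d) → cong₂ _+𝕚_
        (solve 4 (λ a b c d → a :* c :+ :- (b :* d) := c :* a :+ :- (d :* b)) refl a b c d)
        (solve 4 (λ a b c d → a :* d :+ b :* c := c :* b :+ d :* a) refl a b c d) })
    }
  }

module 𝔾-Solver = RingSolver (ACR.fromCommutativeRing 𝔾-commutativeRing) _≟ᵍ_
open 𝔾-Solver using () renaming
  ( solve to solveᵍ; con to conᵍ
  ; _:=_ to _≔_; _:+_ to _⊕_; _:*_ to _⊗_; _:-_ to _⊖_; :-_ to ⊝_ )

-- The finite identity over the Gaussian rationals

module 𝔾-Ring = CommutativeRing 𝔾-commutativeRing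

open RawSemiringDefinitions (Semiring.rawSemiring 𝔾-Ring.semiring)
  using () renaming (_^_ to _^ᵍ_; sum to sumᵍ; product to productᵍ; _×_ to _·ᵍ_)

infixl 6 _-ᵍ_
_-ᵍ_ : 𝔾 → 𝔾 → 𝔾
z -ᵍ w = z +ᵍ -ᵍ w

∑ᵍ ∏ᵍ : ℕ → (ℕ → 𝔾) → 𝔾
∑ᵍ n f = sumᵍ {n} λ k → f (toℕ k)
∏ᵍ n f = productᵍ {n} λ k → f (toℕ k)

module _ {a ℓ} (M : Monoid a ℓ) where
  open Monoid M using (Carrier; _∙_; ∙-congˡ; identityˡ; identityʳ; assoc)
    renaming (_≈_ to _≈ᴹ_; sym to symᴹ; trans to transᴹ)
  open MonoidSum M using () renaming (sum to sumᴹ)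

  -- `sum` unfolds at its first term, whereas the recursions below grow at the last. Stating this
  -- for a monoid serves sums and products at once.
  sum-last : ∀ n (f : ℕ → Carrier) →
    sumᴹ {suc n} (λ k → f (toℕ k)) ≈ᴹ sumᴹ {n} (λ k → f (toℕ k)) ∙ f n
  sum-last zero    f = transᴹ (identityʳ (f 0)) (symᴹ (identityˡ (f 0)))
  sum-last (suc n) f = transᴹ
    (∙-congˡ (sum-last n λ k → f (suc k)))
    (symᴹ (assoc (f 0) (sumᴹ {n} λ k → f (suc (toℕ k))) (f (suc n))))

∑ᵍ-last : ∀ n f → ∑ᵍ (suc n) f ≡ ∑ᵍ n f +ᵍ f n
∑ᵍ-last = sum-last 𝔾-Ring.+-monoid

∏ᵍ-last : ∀ n f → ∏ᵍ (suc n) f ≡ ∏ᵍ n f *ᵍ f n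
∏ᵍ-last = sum-last 𝔾-Ring.*-monoid

∑ᵍ-cong-< : ∀ n {f g} → (∀ k → k ℕ.< n → f k ≡ g k) → ∑ᵍ n f ≡ ∑ᵍ n g
∑ᵍ-cong-< n f≗g = MonoidSum.sum-cong-≗ 𝔾-Ring.+-monoid {n} λ k → f≗g (toℕ k) (toℕ<n k)

∑ᵍ-cong : ∀ n {f g} → (∀ k → f k ≡ g k) → ∑ᵍ n f ≡ ∑ᵍ n g
∑ᵍ-cong n f≗g = ∑ᵍ-cong-< n λ k _ → f≗g k

∏ᵍ-cong : ∀ n {f g} → (∀ k → f k ≡ g k) → ∏ᵍ n f ≡ ∏ᵍ n g
∏ᵍ-cong n f≗g = MonoidSum.sum-cong-≗ 𝔾-Ring.*-monoid {n} λ k → f≗g (toℕ k)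

∑ᵍ-+ : ∀ n f g → ∑ᵍ n (λ k → f k +ᵍ g k) ≡ ∑ᵍ n f +ᵍ ∑ᵍ n g
∑ᵍ-+ n f g = CommutativeMonoidSum.∑-distrib-+ 𝔾-Ring.+-commutativeMonoid {n}
  (λ k → f (toℕ k)) (λ k → g (toℕ k))

∑ᵍ-* : ∀ n z f → ∑ᵍ n (λ k → z *ᵍ f k) ≡ z *ᵍ ∑ᵍ n f
∑ᵍ-* n z f = sym (SemiringSum.*-distribˡ-sum 𝔾-Ring.semiring {n} z λ k → f (toℕ k))

^ᵍ-+ : ∀ z m n → z ^ᵍ (m ℕ.+ n) ≡ z ^ᵍ m *ᵍ z ^ᵍ n
^ᵍ-+ z m n = MonoidMult.×-homo-+ 𝔾-Ring.*-monoid z m n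

·ᵍ-+ : ∀ z m n → (m ℕ.+ n) ·ᵍ z ≡ m ·ᵍ z +ᵍ n ·ᵍ z
·ᵍ-+ z m n = MonoidMult.×-homo-+ 𝔾-Ring.+-monoid z m n

-- Turns a multiplicity into a ring factor, which the ring solver can treat as an atom.
·ᵍ≡* : ∀ n z → n ·ᵍ z ≡ (n ·ᵍ 1ᵍ) *ᵍ z
·ᵍ≡* zero    z = solveᵍ 1 (λ z → conᵍ 0ᵍ ≔ conᵍ 0ᵍ ⊗ z) refl z
·ᵍ≡* (suc n) z = trans (cong (z +ᵍ_) (·ᵍ≡* n z))
  (solveᵍ 2 (λ z m → z ⊕ m ⊗ z ≔ (conᵍ 1ᵍ ⊕ m) ⊗ z) refl z (n ·ᵍ 1ᵍ))

[1+n]C2 : ∀ n → suc n C 2 ≡ n ℕ.+ n C 2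
[1+n]C2 n = trans (sym (nCk+nC[k+1]≡[n+1]C[k+1] n 1)) (cong (ℕ._+ n C 2) (nC1≡n n))

module _ (q : 𝔾) where

  -- (q;q)_n
  qFac : ℕ → 𝔾
  qFac n = ∏ᵍ n λ j → 1ᵍ -ᵍ q *ᵍ q ^ᵍ j

  sign : ℕ → 𝔾
  sign k = (-ᵍ 1ᵍ) ^ᵍ k *ᵍ q ^ᵍ (k C 2)

  -- The coefficient of x^k in ∏_{j<n} (1 - x q^j).
  coeff : ℕ → ℕ → 𝔾
  coeff n       zero    = 1ᵍ
  coeff zero    (suc k) = 0ᵍ
  coeff (suc n) (suc k) = coeff n (suc k) -ᵍ q ^ᵍ n *ᵍ coeff n k

  qFac-suc : ∀ n → qFac (suc n) ≡ qFac n *ᵍ (1ᵍ -ᵍ q ^ᵍ suc n)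
  qFac-suc n = ∏ᵍ-last n λ j → 1ᵍ -ᵍ q *ᵍ q ^ᵍ j

  sign-suc : ∀ k → sign (suc k) ≡ -ᵍ (q ^ᵍ k *ᵍ sign k)
  sign-suc k = trans
    (cong (λ m → (-ᵍ 1ᵍ) ^ᵍ suc k *ᵍ m)
      (trans (cong (q ^ᵍ_) ([1+n]C2 k)) (^ᵍ-+ q k (k C 2))))
    (solveᵍ 3 (λ s x y → (⊝ conᵍ 1ᵍ) ⊗ s ⊗ (x ⊗ y) ≔ ⊝ (x ⊗ (s ⊗ y))) refl
      ((-ᵍ 1ᵍ) ^ᵍ k) (q ^ᵍ k) (q ^ᵍ (k C 2)))

  coeff≡0 : ∀ {n k} → n ℕ.< k → coeff n k ≡ 0ᵍ
  coeff≡0 {zero}  {suc k} _ = refl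
  coeff≡0 {suc n} {suc k} (s≤s n<k) = trans
    (cong₂ (λ x y → x -ᵍ q ^ᵍ n *ᵍ y) (coeff≡0 (ℕ.m<n⇒m<1+n n<k)) (coeff≡0 n<k))
    (solveᵍ 1 (λ x → conᵍ 0ᵍ ⊖ x ⊗ conᵍ 0ᵍ ≔ conᵍ 0ᵍ) refl (q ^ᵍ n))

  -- Induction on `n`, using the claim at `k + 1` and at `k`. Being free of division it holds for
  -- every `q`, and for k ≥ n both sides vanish. It yields the closed form of `coeff` as well as the
  -- bounds on it.
  coeff-ratio : ∀ n k →
    (1ᵍ -ᵍ q ^ᵍ suc k) *ᵍ coeff n (suc k) ≡ -ᵍ ((q ^ᵍ k -ᵍ q ^ᵍ n) *ᵍ coeff n k)
  coeff-ratio zero zero =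
    solveᵍ 1 (λ q → (conᵍ 1ᵍ ⊖ q ⊗ conᵍ 1ᵍ) ⊗ conᵍ 0ᵍ ≔ ⊝ ((conᵍ 1ᵍ ⊖ conᵍ 1ᵍ) ⊗ conᵍ 1ᵍ))
      refl q
  coeff-ratio zero (suc k) =
    solveᵍ 2 (λ q x → (conᵍ 1ᵍ ⊖ q ⊗ (q ⊗ x)) ⊗ conᵍ 0ᵍ ≔ ⊝ ((q ⊗ x ⊖ conᵍ 1ᵍ) ⊗ conᵍ 0ᵍ))
      refl q (q ^ᵍ k)
  coeff-ratio (suc n) zero = trans
    (solveᵍ 3 (λ q y c → (conᵍ 1ᵍ ⊖ q ⊗ conᵍ 1ᵍ) ⊗ (c ⊖ y ⊗ conᵍ 1ᵍ)
        ≔ (conᵍ 1ᵍ ⊖ q ⊗ conᵍ 1ᵍ) ⊗ c ⊖ (conᵍ 1ᵍ ⊖ q ⊗ conᵍ 1ᵍ) ⊗ y)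
      refl q (q ^ᵍ n) (coeff n 1))
    (trans (cong (_-ᵍ (1ᵍ -ᵍ q *ᵍ 1ᵍ) *ᵍ q ^ᵍ n) (coeff-ratio n zero))
      (solveᵍ 2 (λ q y → ⊝ ((conᵍ 1ᵍ ⊖ y) ⊗ conᵍ 1ᵍ) ⊖ (conᵍ 1ᵍ ⊖ q ⊗ conᵍ 1ᵍ) ⊗ y
          ≔ ⊝ ((conᵍ 1ᵍ ⊖ q ⊗ y) ⊗ conᵍ 1ᵍ))
        refl q (q ^ᵍ n)))
  coeff-ratio (suc n) (suc k) = trans
    (solveᵍ 5 (λ q x y c d → (conᵍ 1ᵍ ⊖ q ⊗ (q ⊗ x)) ⊗ (d ⊖ y ⊗ c)
        ≔ (conᵍ 1ᵍ ⊖ q ⊗ (q ⊗ x)) ⊗ d ⊖ (conᵍ 1ᵍ ⊖ q ⊗ (q ⊗ x)) ⊗ (y ⊗ c))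
      refl q x y c d)
    (trans (cong (_-ᵍ (1ᵍ -ᵍ q *ᵍ (q *ᵍ x)) *ᵍ (y *ᵍ c)) (coeff-ratio n (suc k)))
      (trans
        -- The terms are regrouped so that the left side of the claim at (n, k) appears.
        (solveᵍ 4 (λ q x y c →
            ⊝ ((q ⊗ x ⊖ y) ⊗ c) ⊖ (conᵍ 1ᵍ ⊖ q ⊗ (q ⊗ x)) ⊗ (y ⊗ c)
            ≔ ⊝ ((q ⊗ x ⊖ q ⊗ y) ⊗ c) ⊖ q ⊗ y ⊗ ((conᵍ 1ᵍ ⊖ q ⊗ x) ⊗ c))
          refl q x y c)
        (trans (cong (λ u → -ᵍ ((q *ᵍ x -ᵍ q *ᵍ y) *ᵍ c) -ᵍ q *ᵍ y *ᵍ u) (coeff-ratio n k))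
          (solveᵍ 5 (λ q x y c b →
              ⊝ ((q ⊗ x ⊖ q ⊗ y) ⊗ c) ⊖ q ⊗ y ⊗ (⊝ ((x ⊖ y) ⊗ b))
              ≔ ⊝ ((q ⊗ x ⊖ q ⊗ y) ⊗ (c ⊖ y ⊗ b)))
            refl q x y c (coeff n k)))))
    where
    x = q ^ᵍ k
    y = q ^ᵍ n
    c = coeff n (suc k)
    d = coeff n (suc (suc k))

  -- Induction on `k` with k + j fixed: since q^k - q^n = q^k (1 - q^(j+1)), `coeff-ratio` supplies
  -- exactly the factor that turns `qFac j` into `qFac (suc j)`. Writing n as `k + j` avoids
  -- truncated subtraction.
  qFac-coeff : ∀ k j →
    qFac k *ᵍ qFac j *ᵍ coeff (k ℕ.+ j) k ≡ qFac (k ℕ.+ j) *ᵍ sign k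
  qFac-coeff zero    j = solveᵍ 1 (λ p → conᵍ 1ᵍ ⊗ p ⊗ conᵍ 1ᵍ ≔ p ⊗ (conᵍ 1ᵍ ⊗ conᵍ 1ᵍ)) refl (qFac j)
  qFac-coeff (suc k) j = begin
    qFac (suc k) *ᵍ p *ᵍ coeff n (suc k)
      ≡⟨ cong (λ u → u *ᵍ p *ᵍ coeff n (suc k)) (qFac-suc k) ⟩
    r *ᵍ (1ᵍ -ᵍ q ^ᵍ suc k) *ᵍ p *ᵍ coeff n (suc k)
      ≡⟨ solveᵍ 4 (λ r t p c → r ⊗ t ⊗ p ⊗ c ≔ r ⊗ p ⊗ (t ⊗ c)) refl
          r (1ᵍ -ᵍ q ^ᵍ suc k) p (coeff n (suc k)) ⟩
    r *ᵍ p *ᵍ ((1ᵍ -ᵍ q ^ᵍ suc k) *ᵍ coeff n (suc k))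
      ≡⟨ cong (r *ᵍ p *ᵍ_) (coeff-ratio n k) ⟩
    r *ᵍ p *ᵍ -ᵍ ((q ^ᵍ k -ᵍ q ^ᵍ n) *ᵍ coeff n k)
      ≡⟨ cong (λ u → r *ᵍ p *ᵍ -ᵍ ((q ^ᵍ k -ᵍ u) *ᵍ coeff n k))
          (trans (cong (q ^ᵍ_) (sym (ℕ.+-suc k j))) (^ᵍ-+ q k (suc j))) ⟩
    r *ᵍ p *ᵍ -ᵍ ((q ^ᵍ k -ᵍ q ^ᵍ k *ᵍ q ^ᵍ suc j) *ᵍ coeff n k)
      ≡⟨ solveᵍ 5 (λ r p x y c →
            r ⊗ p ⊗ (⊝ ((x ⊖ x ⊗ y) ⊗ c)) ≔ ⊝ (x ⊗ (r ⊗ (p ⊗ (conᵍ 1ᵍ ⊖ y)) ⊗ c)))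
          refl r p (q ^ᵍ k) (q ^ᵍ suc j) (coeff n k) ⟩
    -ᵍ (q ^ᵍ k *ᵍ (r *ᵍ (p *ᵍ (1ᵍ -ᵍ q ^ᵍ suc j)) *ᵍ coeff n k))
      ≡⟨ cong₂ (λ u m → -ᵍ (q ^ᵍ k *ᵍ (r *ᵍ u *ᵍ coeff m k)))
          (sym (qFac-suc j)) (sym (ℕ.+-suc k j)) ⟩
    -ᵍ (q ^ᵍ k *ᵍ (r *ᵍ qFac (suc j) *ᵍ coeff (k ℕ.+ suc j) k))
      ≡⟨ cong (λ u → -ᵍ (q ^ᵍ k *ᵍ u)) (qFac-coeff k (suc j)) ⟩
    -ᵍ (q ^ᵍ k *ᵍ (qFac (k ℕ.+ suc j) *ᵍ sign k))
      ≡⟨ cong (λ m → -ᵍ (q ^ᵍ k *ᵍ (qFac m *ᵍ sign k))) (ℕ.+-suc k j) ⟩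
    -ᵍ (q ^ᵍ k *ᵍ (qFac n *ᵍ sign k))
      ≡⟨ solveᵍ 3 (λ x p s → ⊝ (x ⊗ (p ⊗ s)) ≔ p ⊗ (⊝ (x ⊗ s))) refl
          (q ^ᵍ k) (qFac n) (sign k) ⟩
    qFac n *ᵍ -ᵍ (q ^ᵍ k *ᵍ sign k)
      ≡⟨ cong (qFac n *ᵍ_) (sym (sign-suc k)) ⟩
    qFac n *ᵍ sign (suc k) ∎
    where
    open ≡-Reasoning
    n = suc (k ℕ.+ j)
    p = qFac j
    r = qFac k

  -- Moments of the coefficients

  moment : (ℕ → ℕ) → ℕ → 𝔾
  moment f n = ∑ᵍ (suc n) λ k → f k ·ᵍ coeff n k

  -- The recursion of `coeff` covers only k ≥ 1, so the term at k = 0, which is the same in both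
  -- rows, is split off and then put back.
  moment-suc : ∀ f n →
    moment f (suc n) ≡ moment f n -ᵍ q ^ᵍ n *ᵍ moment (λ k → f (suc k)) n
  moment-suc f n = begin
    f 0 ·ᵍ 1ᵍ +ᵍ ∑ᵍ (suc n) (λ k → f (suc k) ·ᵍ coeff (suc n) (suc k))
      ≡⟨ cong (f 0 ·ᵍ 1ᵍ +ᵍ_) (trans (∑ᵍ-cong (suc n) term)
          (trans
            (∑ᵍ-+ (suc n) (λ k → f (suc k) ·ᵍ coeff n (suc k))
              (λ k → -ᵍ (q ^ᵍ n) *ᵍ (f (suc k) ·ᵍ coeff n k)))
            (cong (tail +ᵍ_) (∑ᵍ-* (suc n) (-ᵍ (q ^ᵍ n)) λ k → f (suc k) ·ᵍ coeff n k)))) ⟩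
    f 0 ·ᵍ 1ᵍ +ᵍ (tail +ᵍ -ᵍ (q ^ᵍ n) *ᵍ m₁)
      ≡⟨ solveᵍ 4 (λ a b x y → a ⊕ (b ⊕ ⊝ x ⊗ y) ≔ (a ⊕ b) ⊖ x ⊗ y) refl
          (f 0 ·ᵍ 1ᵍ) tail (q ^ᵍ n) m₁ ⟩
    ∑ᵍ (suc (suc n)) (λ k → f k ·ᵍ coeff n k) -ᵍ q ^ᵍ n *ᵍ m₁
      -- The index runs one past row `n`; the surplus coefficient `coeff n (suc n)` is zero.
      ≡⟨ cong (_-ᵍ q ^ᵍ n *ᵍ m₁) (∑ᵍ-last (suc n) λ k → f k ·ᵍ coeff n k) ⟩
    moment f n +ᵍ f (suc n) ·ᵍ coeff n (suc n) -ᵍ q ^ᵍ n *ᵍ m₁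
      ≡⟨ cong (λ u → moment f n +ᵍ u -ᵍ q ^ᵍ n *ᵍ m₁)
          (trans (·ᵍ≡* (f (suc n)) _) (cong ((f (suc n) ·ᵍ 1ᵍ) *ᵍ_) (coeff≡0 (ℕ.n<1+n n)))) ⟩
    moment f n +ᵍ (f (suc n) ·ᵍ 1ᵍ) *ᵍ 0ᵍ -ᵍ q ^ᵍ n *ᵍ m₁
      ≡⟨ solveᵍ 3 (λ a b y → a ⊕ b ⊗ conᵍ 0ᵍ ⊖ y ≔ a ⊖ y) refl
          (moment f n) (f (suc n) ·ᵍ 1ᵍ) (q ^ᵍ n *ᵍ m₁) ⟩
    moment f n -ᵍ q ^ᵍ n *ᵍ m₁ ∎
    where
    open ≡-Reasoning
    m₁ = moment (λ k → f (suc k)) n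
    tail = ∑ᵍ (suc n) λ k → f (suc k) ·ᵍ coeff n (suc k)
    term : ∀ k → f (suc k) ·ᵍ coeff (suc n) (suc k) ≡
      f (suc k) ·ᵍ coeff n (suc k) +ᵍ -ᵍ (q ^ᵍ n) *ᵍ (f (suc k) ·ᵍ coeff n k)
    term k = trans (·ᵍ≡* (f (suc k)) _)
      (trans
        (solveᵍ 4 (λ m a x b → m ⊗ (a ⊖ x ⊗ b) ≔ m ⊗ a ⊕ ⊝ x ⊗ (m ⊗ b)) refl
          (f (suc k) ·ᵍ 1ᵍ) (coeff n (suc k)) (q ^ᵍ n) (coeff n k))
        (cong₂ (λ u v → u +ᵍ -ᵍ (q ^ᵍ n) *ᵍ v)
          (sym (·ᵍ≡* (f (suc k)) _)) (sym (·ᵍ≡* (f (suc k)) _))))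

  moment-cong : ∀ {f g} → (∀ k → f k ≡ g k) → ∀ n → moment f n ≡ moment g n
  moment-cong f≗g n = ∑ᵍ-cong (suc n) λ k → cong (_·ᵍ coeff n k) (f≗g k)

  moment-+ : ∀ f g n → moment (λ k → f k ℕ.+ g k) n ≡ moment f n +ᵍ moment g n
  moment-+ f g n = trans (∑ᵍ-cong (suc n) λ k → ·ᵍ-+ (coeff n k) (f k) (g k))
    (∑ᵍ-+ (suc n) (λ k → f k ·ᵍ coeff n k) (λ k → g k ·ᵍ coeff n k))

  -- The value at x = 1 of ∏_{j ≤ n} (1 - x q^j), whose factor j = 0 vanishes there.
  moment₀ : ∀ n → moment (λ _ → 1) (suc n) ≡ 0ᵍ
  moment₀ zero    = moment-suc (λ _ → 1) 0
  moment₀ (suc n) = trans (moment-suc (λ _ → 1) (suc n))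
    (trans (cong (λ u → u -ᵍ q ^ᵍ suc n *ᵍ u) (moment₀ n))
      (solveᵍ 1 (λ x → conᵍ 0ᵍ ⊖ x ⊗ conᵍ 0ᵍ ≔ conᵍ 0ᵍ) refl (q ^ᵍ suc n)))

  -- The derivative of the same product at x = 1, where only the derivative of the factor 1 - x
  -- survives. In the recursion k + 1 splits as 1 + k, and `moment₀` removes the first part.
  moment₁ : ∀ n → moment (λ k → k) (suc n) ≡ -ᵍ qFac n
  moment₁ zero    = moment-suc (λ k → k) 0
  moment₁ (suc n) = begin
    moment (λ k → k) (suc (suc n))
      ≡⟨ moment-suc (λ k → k) (suc n) ⟩
    moment (λ k → k) (suc n) -ᵍ x *ᵍ moment suc (suc n)
      ≡⟨ cong (λ u → moment (λ k → k) (suc n) -ᵍ x *ᵍ u) (moment-+ (λ _ → 1) (λ k → k) (suc n)) ⟩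
    moment (λ k → k) (suc n) -ᵍ x *ᵍ (moment (λ _ → 1) (suc n) +ᵍ moment (λ k → k) (suc n))
      ≡⟨ cong₂ (λ u v → v -ᵍ x *ᵍ (u +ᵍ v)) (moment₀ n) (moment₁ n) ⟩
    -ᵍ qFac n -ᵍ x *ᵍ (0ᵍ +ᵍ -ᵍ qFac n)
      ≡⟨ solveᵍ 2 (λ x p → ⊝ p ⊖ x ⊗ (conᵍ 0ᵍ ⊕ ⊝ p) ≔ ⊝ (p ⊗ (conᵍ 1ᵍ ⊖ x))) refl x (qFac n) ⟩
    -ᵍ (qFac n *ᵍ (1ᵍ -ᵍ x))
      ≡⟨ cong -ᵍ_ (sym (qFac-suc n)) ⟩
    -ᵍ qFac (suc n) ∎
    where
    open ≡-Reasoning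
    x = q ^ᵍ suc n

  -- Half the second derivative at x = 1. The Lambert terms enter through the equation that
  -- characterises them, so the induction stays inside the ring.
  moment₂ : (h : ℕ → 𝔾) → (∀ k → (1ᵍ -ᵍ q ^ᵍ suc k) *ᵍ h k ≡ q ^ᵍ suc k) →
    ∀ n → moment (λ k → k C 2) (suc n) ≡ qFac n *ᵍ ∑ᵍ n h
  moment₂ h h-eq zero    = moment-suc (λ k → k C 2) 0
  moment₂ h h-eq (suc n) = begin
    moment (λ k → k C 2) (suc (suc n))
      ≡⟨ moment-suc (λ k → k C 2) (suc n) ⟩
    m₂ -ᵍ x *ᵍ moment (λ k → suc k C 2) (suc n)
      ≡⟨ cong (λ u → m₂ -ᵍ x *ᵍ u)
          (trans (moment-cong [1+n]C2 (suc n)) (moment-+ (λ k → k) (λ k → k C 2) (suc n))) ⟩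
    m₂ -ᵍ x *ᵍ (moment (λ k → k) (suc n) +ᵍ m₂)
      ≡⟨ cong₂ (λ u v → v -ᵍ x *ᵍ (u +ᵍ v)) (moment₁ n) (moment₂ h h-eq n) ⟩
    p *ᵍ s -ᵍ x *ᵍ (-ᵍ p +ᵍ p *ᵍ s)
      ≡⟨ solveᵍ 3 (λ p s x → p ⊗ s ⊖ x ⊗ (⊝ p ⊕ p ⊗ s) ≔ p ⊗ (conᵍ 1ᵍ ⊖ x) ⊗ s ⊕ p ⊗ x)
          refl p s x ⟩
    p *ᵍ (1ᵍ -ᵍ x) *ᵍ s +ᵍ p *ᵍ x
      -- `h-eq` trades the lone q^(n+1) for (1 - q^(n+1)) h(n), so that the new factor of `qFac`
      -- comes out of both summands.
      ≡⟨ cong (λ u → p *ᵍ (1ᵍ -ᵍ x) *ᵍ s +ᵍ p *ᵍ u) (sym (h-eq n)) ⟩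
    p *ᵍ (1ᵍ -ᵍ x) *ᵍ s +ᵍ p *ᵍ ((1ᵍ -ᵍ x) *ᵍ h n)
      ≡⟨ solveᵍ 4 (λ p t s u → p ⊗ t ⊗ s ⊕ p ⊗ (t ⊗ u) ≔ p ⊗ t ⊗ (s ⊕ u)) refl
          p (1ᵍ -ᵍ x) s (h n) ⟩
    p *ᵍ (1ᵍ -ᵍ x) *ᵍ (s +ᵍ h n)
      ≡⟨ cong₂ _*ᵍ_ (sym (qFac-suc n)) (sym (∑ᵍ-last n h)) ⟩
    qFac (suc n) *ᵍ ∑ᵍ (suc n) h ∎
    where
    open ≡-Reasoning
    x = q ^ᵍ suc n
    p = qFac n
    s = ∑ᵍ n h
    m₂ = moment (λ k → k C 2) (suc n)

-- Bounds on moduli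

0≤1 : 0ℚ ℚ.≤ 1ℚ
0≤1 = ℚ.nonNegative⁻¹ 1ℚ

+-nonneg : ∀ {p r} → 0ℚ ℚ.≤ p → 0ℚ ℚ.≤ r → 0ℚ ℚ.≤ p ℚ.+ r
+-nonneg = ℚ.+-mono-≤

*-nonneg : ∀ {p r} → 0ℚ ℚ.≤ p → 0ℚ ℚ.≤ r → 0ℚ ℚ.≤ p ℚ.* r
*-nonneg {p} {r} 0≤p 0≤r = ℚ.nonNegative⁻¹ (p ℚ.* r)
  {{ℚ.nonNeg*nonNeg⇒nonNeg p {{ℚ.nonNegative 0≤p}} r {{ℚ.nonNegative 0≤r}}}}

*-mono-≤ : ∀ {a b c d} → 0ℚ ℚ.≤ a → 0ℚ ℚ.≤ b → a ℚ.≤ c → b ℚ.≤ d → a ℚ.* b ℚ.≤ c ℚ.* d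
*-mono-≤ {a} {b} {c} {d} 0≤a 0≤b a≤c b≤d = ℚ.≤-trans
  (ℚ.*-monoʳ-≤-nonNeg b {{ℚ.nonNegative 0≤b}} a≤c)
  (ℚ.*-monoˡ-≤-nonNeg c {{ℚ.nonNegative (ℚ.≤-trans 0≤a a≤c)}} b≤d)

*-monoˡ-≤ : ∀ {a b c} → 0ℚ ℚ.≤ a → b ℚ.≤ c → a ℚ.* b ℚ.≤ a ℚ.* c
*-monoˡ-≤ {a} 0≤a = ℚ.*-monoˡ-≤-nonNeg a {{ℚ.nonNegative 0≤a}}

*-monoʳ-≤ : ∀ {a b c} → 0ℚ ℚ.≤ a → b ℚ.≤ c → b ℚ.* a ℚ.≤ c ℚ.* a
*-monoʳ-≤ {a} 0≤a = ℚ.*-monoʳ-≤-nonNeg a {{ℚ.nonNegative 0≤a}}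

p≤p+r : ∀ {p r} → 0ℚ ℚ.≤ r → p ℚ.≤ p ℚ.+ r
p≤p+r {p} {r} 0≤r = subst (ℚ._≤ p ℚ.+ r) (ℚ.+-identityʳ p) (ℚ.+-monoʳ-≤ p 0≤r)

p≤r+p : ∀ {p r} → 0ℚ ℚ.≤ r → p ℚ.≤ r ℚ.+ p
p≤r+p {p} {r} 0≤r = subst (p ℚ.≤_) (ℚ.+-comm p r) (p≤p+r 0≤r)

square-cancel-≤ : ∀ {p r} → 0ℚ ℚ.≤ r → p ℚ.* p ℚ.≤ r ℚ.* r → p ℚ.≤ r
square-cancel-≤ {p} {r} 0≤r p²≤r² with p ℚ.≤? r
... | yes p≤r = p≤r
... | no p≰r = ⊥-elim (ℚ.<-irrefl refl
        (ℚ.<-≤-trans (*-mono-< {r} {r} {p} {p} 0≤r 0≤r (ℚ.≰⇒> p≰r) (ℚ.≰⇒> p≰r)) p²≤r²))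

-- Natural numbers in ℚ and the Archimedean property

ι : ℕ → ℚ
ι zero    = 0ℚ
ι (suc n) = 1ℚ ℚ.+ ι n

0≤ι : ∀ n → 0ℚ ℚ.≤ ι n
0≤ι zero    = ℚ.≤-refl
0≤ι (suc n) = +-nonneg 0≤1 (0≤ι n)

ι-mono : ∀ {m n} → m ≤ n → ι m ℚ.≤ ι n
ι-mono {n = n} z≤n = 0≤ι n
ι-mono (s≤s m≤n)   = ℚ.+-monoʳ-≤ 1ℚ (ι-mono m≤n)

ι-+ : ∀ m n → ι (m ℕ.+ n) ≡ ι m ℚ.+ ι n
ι-+ zero    n = sym (ℚ.+-identityˡ (ι n))
ι-+ (suc m) n = trans (cong (1ℚ ℚ.+_) (ι-+ m n)) (sym (ℚ.+-assoc 1ℚ (ι m) (ι n)))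

ιC2≤ι² : ∀ k → ι (k C 2) ℚ.≤ ι k ℚ.* ι k
ιC2≤ι² zero    = ℚ.≤-refl
ιC2≤ι² (suc k) = subst₂ ℚ._≤_
  (trans (sym (ι-+ k (k C 2))) (cong ι (sym ([1+n]C2 k))))
  (solve 1 (λ x → x :+ x :* x :+ (con 1ℚ :+ x) := (con 1ℚ :+ x) :* (con 1ℚ :+ x)) refl (ι k))
  (ℚ.≤-trans (ℚ.+-monoʳ-≤ (ι k) (ιC2≤ι² k)) (p≤p+r (0≤ι (suc k))))

ι-toℚᵘ : ∀ n → ℚ.toℚᵘ (ι n) ℚᵘ.≃ ℚᵘ.mkℚᵘ (+ n) 0
ι-toℚᵘ zero    = ℚᵘ.≃-refl
ι-toℚᵘ (suc n) = ℚᵘ.≃-trans (ℚ.toℚᵘ-homo-+ 1ℚ (ι n))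
  (ℚᵘ.≃-trans (ℚᵘ.+-congʳ (ℚ.toℚᵘ 1ℚ) (ι-toℚᵘ n))
    (ℚᵘ.*≡* (cong (λ i → (+ 1 ℤ.+ i) ℤ.* + 1) (ℤ.*-identityʳ (+ n)))))

p<ι : ∀ p → ∃ λ n → p ℚ.< ι n
p<ι (mkℚ -[1+ m ] d-1 c) = 1 , ℚ.*<* ℤ.-<+
-- A nonnegative m/d with d ≥ 1 is at most m, hence below m + 1.
p<ι (mkℚ (+ m) d-1 c) = suc m , ℚ.toℚᵘ-cancel-<
  (ℚᵘ.<-respʳ-≃ (ℚᵘ.≃-sym (ι-toℚᵘ (suc m)))
    (ℚᵘ.*<* (subst₂ ℤ._<_ (sym (ℤ.*-identityʳ (+ m))) (ℤ.pos-* (suc m) (suc d-1))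
      (ℤ.+<+ (ℕ.<-≤-trans (ℕ.n<1+n m) (ℕ.m≤m*n (suc m) (suc d-1)))))))

archimedes : ∀ p {ε} → 0ℚ ℚ.< ε → ∃ λ n → p ℚ.< ι n ℚ.* ε
archimedes p {ε} 0<ε with p<ι (p ℚ.* recip ε)
... | n , p/ε<n = n , subst (ℚ._< ι n ℚ.* ε)
  (trans (ℚ.*-assoc p (recip ε) ε)
    (trans (cong (p ℚ.*_) (trans (ℚ.*-comm (recip ε) ε) (recip-inverse 0<ε))) (ℚ.*-identityʳ p)))
  (ℚ.*-monoˡ-<-pos ε {{ℚ.positive 0<ε}} p/ε<n)

∥_∥² : 𝔾 → ℚ
∥ x +𝕚 y ∥² = x ℚ.* x ℚ.+ y ℚ.* y

0≤∥z∥² : ∀ z → 0ℚ ℚ.≤ ∥ z ∥²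
0≤∥z∥² (x +𝕚 y) = +-nonneg (square-nonneg x) (square-nonneg y)

∥zw∥² : ∀ z w → ∥ z *ᵍ w ∥² ≡ ∥ z ∥² ℚ.* ∥ w ∥²
∥zw∥² (a +𝕚 b) (c +𝕚 d) =
  solve 4 (λ a b c d →
      (a :* c :+ :- (b :* d)) :* (a :* c :+ :- (b :* d))
        :+ (a :* d :+ b :* c) :* (a :* d :+ b :* c)
      := (a :* a :+ b :* b) :* (c :* c :+ d :* d))
    refl a b c d

infix 4 _≼_

-- |z| ≤ b
record _≼_ (z : 𝔾) (b : ℚ) : Set where
  constructor _⊣_
  field
    bound-nonneg : 0ℚ ℚ.≤ b
    ∥∥²≤bound²   : ∥ z ∥² ℚ.≤ b ℚ.* b

open _≼_

≼-weaken : ∀ {z a b} → z ≼ a → a ℚ.≤ b → z ≼ b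
≼-weaken (0≤a ⊣ z≤a) a≤b = ℚ.≤-trans 0≤a a≤b ⊣ ℚ.≤-trans z≤a (*-mono-≤ 0≤a 0≤a a≤b a≤b)

0≼ : ∀ {b} → 0ℚ ℚ.≤ b → 0ᵍ ≼ b
0≼ 0≤b = 0≤b ⊣ *-nonneg 0≤b 0≤b

1≼1 : 1ᵍ ≼ 1ℚ
1≼1 = 0≤1 ⊣ ℚ.≤-refl

≼-neg : ∀ {z a} → z ≼ a → -ᵍ z ≼ a
≼-neg {x +𝕚 y} {a} (0≤a ⊣ z≤a) = 0≤a ⊣ subst (ℚ._≤ a ℚ.* a)
  (solve 2 (λ x y → x :* x :+ y :* y := (:- x) :* (:- x) :+ (:- y) :* (:- y)) refl x y) z≤a

≼-* : ∀ {z w a b} → z ≼ a → w ≼ b → z *ᵍ w ≼ a ℚ.* b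
≼-* {z} {w} {a} {b} (0≤a ⊣ z≤a) (0≤b ⊣ w≤b) = *-nonneg 0≤a 0≤b ⊣ subst₂ ℚ._≤_
  (sym (∥zw∥² z w))
  (solve 2 (λ a b → (a :* a) :* (b :* b) := (a :* b) :* (a :* b)) refl a b)
  (*-mono-≤ (0≤∥z∥² z) (0≤∥z∥² w) z≤a w≤b)

-- Expanding |z + w|² leaves the inner product of `z` and `w` to be bounded by a b. Lagrange's
-- identity |z|²|w|² = inner² + cross² gives this Cauchy-Schwarz bound without square roots.
≼-+ : ∀ {z w a b} → z ≼ a → w ≼ b → z +ᵍ w ≼ a ℚ.+ b
≼-+ {x +𝕚 y} {u +𝕚 v} {a} {b} (0≤a ⊣ z≤a) (0≤b ⊣ w≤b) = +-nonneg 0≤a 0≤b ⊣ subst₂ ℚ._≤_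
  (solve 4 (λ x y u v →
      x :* x :+ y :* y :+ (u :* u :+ v :* v) :+ ((x :* u :+ y :* v) :+ (x :* u :+ y :* v))
      := (x :+ u) :* (x :+ u) :+ (y :+ v) :* (y :+ v)) refl x y u v)
  (solve 2 (λ a b → a :* a :+ b :* b :+ (a :* b :+ a :* b) := (a :+ b) :* (a :+ b)) refl a b)
  (ℚ.+-mono-≤ (ℚ.+-mono-≤ z≤a w≤b) (ℚ.+-mono-≤ inner≤ab inner≤ab))
  where
  inner = x ℚ.* u ℚ.+ y ℚ.* v
  cross = x ℚ.* v ℚ.- y ℚ.* u
  inner≤ab : inner ℚ.≤ a ℚ.* b
  inner≤ab = square-cancel-≤ (*-nonneg 0≤a 0≤b) (ℚ.≤-trans
    (p≤p+r {r = cross ℚ.* cross} (square-nonneg cross))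
    (subst₂ ℚ._≤_
      (solve 4 (λ x y u v → (x :* x :+ y :* y) :* (u :* u :+ v :* v)
          := (x :* u :+ y :* v) :* (x :* u :+ y :* v) :+ (x :* v :- y :* u) :* (x :* v :- y :* u))
        refl x y u v)
      (solve 2 (λ a b → (a :* a) :* (b :* b) := (a :* b) :* (a :* b)) refl a b)
      (*-mono-≤ (0≤∥z∥² (x +𝕚 y)) (0≤∥z∥² (u +𝕚 v)) z≤a w≤b)))

≼-- : ∀ {z w a b} → z ≼ a → w ≼ b → z -ᵍ w ≼ a ℚ.+ b
≼-- {z} {w} z≼a w≼b = ≼-+ {z} { -ᵍ w} z≼a (≼-neg {w} w≼b)

≼⇒reᵍ≤ : ∀ {z a} → z ≼ a → reᵍ z ℚ.≤ a
≼⇒reᵍ≤ {x +𝕚 y} (0≤a ⊣ z≤a) =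
  square-cancel-≤ 0≤a (ℚ.≤-trans (p≤p+r (square-nonneg y)) z≤a)

-- The real part alone suffices: 1 - Re z ≥ 1 - t ≥ 0.
∥1-z∥²≥ : ∀ {z t} → z ≼ t → t ℚ.≤ 1ℚ → (1ℚ ℚ.- t) ℚ.* (1ℚ ℚ.- t) ℚ.≤ ∥ 1ᵍ -ᵍ z ∥²
∥1-z∥²≥ {z@(x +𝕚 y)} {t} z≼t t≤1 = ℚ.≤-trans
  (*-mono-≤ 0≤1-t 0≤1-t 1-t≤1-x 1-t≤1-x) (p≤p+r (square-nonneg (0ℚ ℚ.- y)))
  where
  0≤1-t : 0ℚ ℚ.≤ 1ℚ ℚ.- t
  0≤1-t = subst (ℚ._≤ 1ℚ ℚ.- t) (ℚ.+-inverseʳ t) (ℚ.+-monoˡ-≤ (ℚ.- t) t≤1)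
  1-t≤1-x : 1ℚ ℚ.- t ℚ.≤ 1ℚ ℚ.- x
  1-t≤1-x = ℚ.+-monoʳ-≤ 1ℚ (ℚ.neg-antimono-≤ (≼⇒reᵍ≤ {z} z≼t))

≼-∑ : ∀ n {f b} → 0ℚ ℚ.≤ b → (∀ k → k ℕ.< n → f k ≼ b) → ∑ᵍ n f ≼ ι n ℚ.* b
≼-∑ zero {f} {b} 0≤b _ = 0≼ (*-nonneg ℚ.≤-refl 0≤b)
≼-∑ (suc n) {f} {b} 0≤b f≼b = subst (∑ᵍ (suc n) f ≼_)
  (solve 2 (λ b n → b :+ n :* b := (con 1ℚ :+ n) :* b) refl b (ι n))
  (≼-+ {f 0} {∑ᵍ n λ k → f (suc k)} (f≼b 0 ℕ.z<s) (≼-∑ n 0≤b λ k k<n → f≼b (suc k) (s≤s k<n)))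

≼-· : ∀ n {z b} → z ≼ b → n ·ᵍ z ≼ ι n ℚ.* b
≼-· zero    (0≤b ⊣ _) = 0≼ (*-nonneg ℚ.≤-refl 0≤b)
≼-· (suc n) {z} {b} z≼b = subst (suc n ·ᵍ z ≼_)
  (solve 2 (λ b n → b :+ n :* b := (con 1ℚ :+ n) :* b) refl b (ι n))
  (≼-+ {z} {n ·ᵍ z} z≼b (≼-· n z≼b))

infixl 7 _/ᵍ_
-- Follows the formula of complex division, including the value of `recip` at 0, so that `at`
-- commutes with division by definition.
_/ᵍ_ : 𝔾 → 𝔾 → 𝔾
z /ᵍ w = z *ᵍ ((reᵍ w ℚ.* r) +𝕚 (ℚ.- (imᵍ w ℚ.* r)))
  where r = recip ∥ w ∥²

/ᵍ-inverse : ∀ z {w} → 0ℚ ℚ.< ∥ w ∥² → w *ᵍ (z /ᵍ w) ≡ z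
/ᵍ-inverse (x +𝕚 y) {a +𝕚 b} 0<w = cong₂ _+𝕚_
  (trans
    (solve 5 (λ x y a b r →
        a :* (x :* (a :* r) :+ :- (y :* (:- (b :* r))))
          :+ :- (b :* (x :* (:- (b :* r)) :+ y :* (a :* r)))
        := x :* ((a :* a :+ b :* b) :* r)) refl x y a b r)
    (trans (cong (x ℚ.*_) (recip-inverse 0<w)) (ℚ.*-identityʳ x)))
  (trans
    (solve 5 (λ x y a b r →
        a :* (x :* (:- (b :* r)) :+ y :* (a :* r))
          :+ b :* (x :* (a :* r) :+ :- (y :* (:- (b :* r))))
        := y :* ((a :* a :+ b :* b) :* r)) refl x y a b r)
    (trans (cong (y ℚ.*_) (recip-inverse 0<w)) (ℚ.*-identityʳ y)))
  where r = recip ∥ a +𝕚 b ∥²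

*ᵍ-cancelˡ : ∀ {w z v} → 0ℚ ℚ.< ∥ w ∥² → w *ᵍ z ≡ w *ᵍ v → z ≡ v
*ᵍ-cancelˡ {w} {z} {v} 0<w wz≡wv = begin
  z                        ≡⟨ expand z ⟩
  w *ᵍ z *ᵍ (1ᵍ /ᵍ w)     ≡⟨ cong (_*ᵍ (1ᵍ /ᵍ w)) wz≡wv ⟩
  w *ᵍ v *ᵍ (1ᵍ /ᵍ w)     ≡⟨ sym (expand v) ⟩
  v                        ∎
  where
  open ≡-Reasoning
  expand : ∀ u → u ≡ w *ᵍ u *ᵍ (1ᵍ /ᵍ w)
  expand u = trans
    (trans (sym (𝔾-Ring.*-identityʳ u)) (cong (u *ᵍ_) (sym (/ᵍ-inverse 1ᵍ 0<w))))
    (trans (sym (𝔾-Ring.*-assoc u w (1ᵍ /ᵍ w))) (cong (_*ᵍ (1ᵍ /ᵍ w)) (𝔾-Ring.*-comm u w)))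

-- Estimates uniform in |q| ≤ σ⁴

module Geometric (σ : ℚ) (0<σ : 0ℚ ℚ.< σ) (σ<1 : σ ℚ.< 1ℚ) where

  0<1-σ : 0ℚ ℚ.< 1ℚ ℚ.- σ
  0<1-σ = subst (ℚ._< 1ℚ ℚ.- σ) (ℚ.+-inverseʳ σ) (ℚ.+-monoˡ-< (ℚ.- σ) σ<1)

  -- Γ = 1 + σ + σ² + ⋯
  Γ : ℚ
  Γ = recip (1ℚ ℚ.- σ)

  0≤Γ : 0ℚ ℚ.≤ Γ
  0≤Γ = ℚ.<⇒≤ (recip-pos 0<1-σ)

  Γ≡1+σΓ : Γ ≡ 1ℚ ℚ.+ σ ℚ.* Γ
  Γ≡1+σΓ = trans
    (solve 2 (λ c s → c := (con 1ℚ :- s) :* c :+ s :* c) refl Γ σ)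
    (cong (ℚ._+ σ ℚ.* Γ) (recip-inverse 0<1-σ))

  pow : ℕ → ℚ
  pow zero    = 1ℚ
  pow (suc n) = σ ℚ.* pow n

  0≤pow : ∀ n → 0ℚ ℚ.≤ pow n
  0≤pow zero    = 0≤1
  0≤pow (suc n) = *-nonneg (ℚ.<⇒≤ 0<σ) (0≤pow n)

  σ*-≤ : ∀ {x} → 0ℚ ℚ.≤ x → σ ℚ.* x ℚ.≤ x
  σ*-≤ {x} 0≤x = subst (σ ℚ.* x ℚ.≤_) (ℚ.*-identityˡ x) (*-monoʳ-≤ 0≤x (ℚ.<⇒≤ σ<1))

  pow-antitone : ∀ {m n} → m ≤ n → pow n ℚ.≤ pow m
  pow-antitone {n = zero}  z≤n = ℚ.≤-refl
  pow-antitone {n = suc n} z≤n = ℚ.≤-trans (σ*-≤ (0≤pow n)) (pow-antitone {0} {n} z≤n)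
  pow-antitone (s≤s m≤n) = *-monoˡ-≤ (ℚ.<⇒≤ 0<σ) (pow-antitone m≤n)

  pow≤1 : ∀ n → pow n ℚ.≤ 1ℚ
  pow≤1 n = pow-antitone {0} {n} z≤n

  -- `Γ` is the fixed point of x ↦ 1 + σ x, and (n + 1) σ^(n+1) = σ (σ^n + n σ^n) ≤ σ + σ Γ stays
  -- below it.
  ι*pow≤Γ : ∀ n → ι n ℚ.* pow n ℚ.≤ Γ
  ι*pow≤Γ zero    = ℚ.≤-trans (ℚ.≤-reflexive (ℚ.*-zeroˡ 1ℚ)) 0≤Γ
  ι*pow≤Γ (suc n) = subst₂ ℚ._≤_
    (solve 3 (λ s k p → s :* (p :+ k :* p) := (con 1ℚ :+ k) :* (s :* p)) refl σ (ι n) (pow n))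
    (sym Γ≡1+σΓ)
    (ℚ.≤-trans
      (*-monoˡ-≤ (ℚ.<⇒≤ 0<σ) (ℚ.+-mono-≤ (pow≤1 n) (ι*pow≤Γ n)))
      (subst (ℚ._≤ 1ℚ ℚ.+ σ ℚ.* Γ) (solve 2 (λ s c → s :+ s :* c := s :* (con 1ℚ :+ c)) refl σ Γ)
        (ℚ.+-monoˡ-≤ (σ ℚ.* Γ) (ℚ.<⇒≤ σ<1))))

  -- From n σ^n ≤ Γ follows n (B σ^n) ≤ B Γ, which the Archimedean property puts below n ε.
  pow-null : ∀ B {ε} → 0ℚ ℚ.≤ B → 0ℚ ℚ.< ε → ∃ λ N → ∀ n → N ≤ n → B ℚ.* pow n ℚ.< ε
  pow-null B {ε} 0≤B 0<ε =
    let N , BΓ<Nε = archimedes (B ℚ.* Γ) 0<ε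
    in N , λ n N≤n → ℚ.*-cancelˡ-<-nonNeg (ι n) {{ℚ.nonNegative (0≤ι n)}}
      (ℚ.≤-<-trans
        (subst (ℚ._≤ B ℚ.* Γ)
          (solve 3 (λ b k p → b :* (k :* p) := k :* (b :* p)) refl B (ι n) (pow n))
          (*-monoˡ-≤ 0≤B (ι*pow≤Γ n)))
        (ℚ.<-≤-trans BΓ<Nε (*-monoʳ-≤ (ℚ.<⇒≤ 0<ε) (ι-mono N≤n))))

  pow⁴ : ℕ → ℚ
  pow⁴ n = (pow n ℚ.* pow n) ℚ.* (pow n ℚ.* pow n)

  0≤pow⁴ : ∀ n → 0ℚ ℚ.≤ pow⁴ n
  0≤pow⁴ n = *-nonneg (*-nonneg (0≤pow n) (0≤pow n)) (*-nonneg (0≤pow n) (0≤pow n))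

  pow⁴-antitone : ∀ {m n} → m ≤ n → pow⁴ n ℚ.≤ pow⁴ m
  pow⁴-antitone {m} {n} m≤n = *-mono-≤ 0≤p² 0≤p² p²≤ p²≤
    where
    0≤p² = *-nonneg (0≤pow n) (0≤pow n)
    p²≤ = *-mono-≤ (0≤pow n) (0≤pow n) (pow-antitone m≤n) (pow-antitone m≤n)

  pow⁴≤pow : ∀ n → pow⁴ n ℚ.≤ pow n
  pow⁴≤pow n = subst (pow⁴ n ℚ.≤_)
    (solve 1 (λ p → p :* con 1ℚ :* (con 1ℚ :* con 1ℚ) := p) refl (pow n))
    (*-mono-≤ (*-nonneg 0≤p 0≤p) (*-nonneg 0≤p 0≤p)
      (*-monoˡ-≤ 0≤p (pow≤1 n)) (*-mono-≤ 0≤p 0≤p (pow≤1 n) (pow≤1 n)))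
    where 0≤p = 0≤pow n

  -- Dominates recursions of the shape of `coeff-ratio`: 2 σ^(4k) bounds |q^k - q^n| for k ≤ n, `Γ`
  -- pays for dividing by 1 - q^(k+1), and `b` bounds an inhomogeneous term. It is used with b = 0
  -- for c(n,k), and with b = `K₀` for e(k) - c(n,k) divided by σ^(4n).
  majorant : ℚ → ℕ → ℚ
  majorant b zero    = 1ℚ
  majorant b (suc k) = Γ ℚ.* ((pow⁴ k ℚ.+ pow⁴ k) ℚ.* majorant b k ℚ.+ b)

  module _ {b : ℚ} (0≤b : 0ℚ ℚ.≤ b) where

    0≤majorant : ∀ k → 0ℚ ℚ.≤ majorant b k
    0≤majorant zero    = 0≤1
    0≤majorant (suc k) = *-nonneg 0≤Γ
      (+-nonneg (*-nonneg (+-nonneg (0≤pow⁴ k) (0≤pow⁴ k)) (0≤majorant k)) 0≤b)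

    majorant-prefix : ∀ j → ∃ λ K → 0ℚ ℚ.≤ K × (∀ k → k ≤ j → majorant b k ℚ.≤ K)
    majorant-prefix zero = 1ℚ , 0≤1 , λ { zero z≤n → ℚ.≤-refl }
    majorant-prefix (suc j) = K ℚ.+ majorant b (suc j) , +-nonneg 0≤K (0≤majorant (suc j)) , cases
      where
      K = proj₁ (majorant-prefix j)
      0≤K = proj₁ (proj₂ (majorant-prefix j))
      bound = proj₂ (proj₂ (majorant-prefix j))
      cases : ∀ k → k ≤ suc j → majorant b k ℚ.≤ K ℚ.+ majorant b (suc j)
      cases k k≤1+j with ℕ.m≤n⇒m<n∨m≡n k≤1+j
      ... | inj₁ (s≤s k≤j) = ℚ.≤-trans (bound k k≤j) (p≤p+r (0≤majorant (suc j)))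
      ... | inj₂ refl      = p≤r+p 0≤K

    -- From some index on the factor 2Γ(σ⁴)^k is at most ½, and then K is
    -- preserved by the recursion as soon as K ≥ 2Γb.
    majorant-bounded : ∃ λ K → 0ℚ ℚ.≤ K × (∀ k → majorant b k ℚ.≤ K)
    majorant-bounded = K , 0≤K , bound
      where
      threshold = pow-null (Γ ℚ.+ Γ) (+-nonneg 0≤Γ 0≤Γ) (ℚ.positive⁻¹ ½)
      J = proj₁ threshold
      small = proj₂ threshold
      prefix = majorant-prefix J
      K′ = proj₁ prefix
      Γb = Γ ℚ.* b
      0≤Γb = *-nonneg 0≤Γ 0≤b
      K = K′ ℚ.+ (Γb ℚ.+ Γb)
      0≤K = +-nonneg (proj₁ (proj₂ prefix)) (+-nonneg 0≤Γb 0≤Γb)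

      prefix≤K : ∀ k → k ≤ J → majorant b k ℚ.≤ K
      prefix≤K k k≤J = ℚ.≤-trans (proj₂ (proj₂ prefix) k k≤J) (p≤p+r (+-nonneg 0≤Γb 0≤Γb))

      step : ∀ k → J ≤ k → majorant b k ℚ.≤ K → majorant b (suc k) ℚ.≤ K
      step k J≤k bound = subst₂ ℚ._≤_
        (solve 4 (λ c t m b → c :* (t :+ t) :* m :+ c :* b := c :* ((t :+ t) :* m :+ b)) refl
          Γ (pow⁴ k) (majorant b k) b)
        (solve 1 (λ K → con ½ :* K :+ con ½ :* K := K) refl K)
        (ℚ.+-mono-≤
          (*-mono-≤ (*-nonneg 0≤Γ (+-nonneg (0≤pow⁴ k) (0≤pow⁴ k))) (0≤majorant k)
            (ℚ.≤-trans
              (subst (Γ ℚ.* (pow⁴ k ℚ.+ pow⁴ k) ℚ.≤_)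
                (solve 2 (λ c p → c :* (p :+ p) := (c :+ c) :* p) refl Γ (pow k))
                (*-monoˡ-≤ 0≤Γ (ℚ.+-mono-≤ (pow⁴≤pow k) (pow⁴≤pow k))))
              (ℚ.<⇒≤ (small k J≤k)))
            bound)
          (subst (ℚ._≤ ½ ℚ.* K)
            (solve 1 (λ x → con ½ :* (x :+ x) := x) refl Γb)
            (*-monoˡ-≤ (ℚ.<⇒≤ (ℚ.positive⁻¹ ½)) (p≤r+p (proj₁ (proj₂ prefix))))))

      from-J : ∀ i → majorant b (i ℕ.+ J) ℚ.≤ K
      from-J zero    = prefix≤K J ℕ.≤-refl
      from-J (suc i) = step (i ℕ.+ J) (ℕ.m≤n+m J i) (from-J i)

      bound : ∀ k → majorant b k ℚ.≤ K
      bound k with ℕ.≤-total k J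
      ... | inj₁ k≤J = prefix≤K k k≤J
      ... | inj₂ J≤k = subst (λ k → majorant b k ℚ.≤ K) (ℕ.m∸n+n≡m J≤k) (from-J (k ∸ J))

  abstract
    -- `K₀` is to bound |c(n,k)| and `K₁` to bound |e(k) - c(n,k)| / σ^(4n); both depend on `σ`
    -- only. Being opaque, they enter the estimates through nonnegativity and majorisation alone.
    K₀ : ℚ
    K₀ = proj₁ (majorant-bounded ℚ.≤-refl)

    0≤K₀ : 0ℚ ℚ.≤ K₀
    0≤K₀ = proj₁ (proj₂ (majorant-bounded ℚ.≤-refl))

    majorant≤K₀ : ∀ k → majorant 0ℚ k ℚ.≤ K₀
    majorant≤K₀ = proj₂ (proj₂ (majorant-bounded ℚ.≤-refl))

    K₁ : ℚ
    K₁ = proj₁ (majorant-bounded 0≤K₀)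

    0≤K₁ : 0ℚ ℚ.≤ K₁
    0≤K₁ = proj₁ (proj₂ (majorant-bounded 0≤K₀))

    majorant≤K₁ : ∀ k → majorant K₀ k ℚ.≤ K₁
    majorant≤K₁ = proj₂ (proj₂ (majorant-bounded 0≤K₀))

  cube : ℚ → ℚ
  cube x = x ℚ.* (x ℚ.* x)

  -- Each factor n costs one factor σ^n, so σ⁴ pays for n³ and leaves geometric decay.
  cube-pow⁴ : ∀ n → cube (ι (suc (suc n))) ℚ.* pow⁴ (suc n) ℚ.≤ cube (1ℚ ℚ.+ Γ) ℚ.* pow n
  cube-pow⁴ n = subst (ℚ._≤ cube (1ℚ ℚ.+ Γ) ℚ.* pow n)
    (solve 2 (λ k p →
        ((k :* p) :* ((k :* p) :* (k :* p))) :* p := k :* (k :* k) :* ((p :* p) :* (p :* p)))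
      refl (ι (suc (suc n))) (pow (suc n)))
    (*-mono-≤ (*-nonneg 0≤y (*-nonneg 0≤y 0≤y)) (0≤pow (suc n))
      (*-mono-≤ 0≤y (*-nonneg 0≤y 0≤y) y≤ (*-mono-≤ 0≤y 0≤y y≤ y≤))
      (σ*-≤ (0≤pow n)))
    where
    y = ι (suc (suc n)) ℚ.* pow (suc n)
    0≤y : 0ℚ ℚ.≤ y
    0≤y = *-nonneg (0≤ι (suc (suc n))) (0≤pow (suc n))
    y≤ : y ℚ.≤ 1ℚ ℚ.+ Γ
    -- As n + 2 = 1 + (n + 1), one power is bounded by 1 and the other n + 1 together by `Γ`.
    y≤ = subst (ℚ._≤ 1ℚ ℚ.+ Γ)
      (solve 2 (λ k p → p :+ k :* p := (con 1ℚ :+ k) :* p) refl (ι (suc n)) (pow (suc n)))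
      (ℚ.+-mono-≤ (pow≤1 (suc n)) (ι*pow≤Γ (suc n)))

  -- A geometric series summed from its first step: B Γ σ^(n+1) + B σ^n = B Γ σ^n, by Γ = 1 + σ Γ.
  -- The bound is independent of `m`, as the diagonal limit requires.
  telescope : ∀ (f : ℕ → 𝔾) {B} → 0ℚ ℚ.≤ B → (∀ n → f (suc n) -ᵍ f n ≼ B ℚ.* pow n) →
    ∀ {n m} → n ≤ m → f m -ᵍ f n ≼ B ℚ.* Γ ℚ.* pow n
  telescope f {B} 0≤B step {n} {m} n≤m =
    subst (λ m → f m -ᵍ f n ≼ B ℚ.* Γ ℚ.* pow n) (ℕ.m∸n+n≡m n≤m) (go (m ∸ n) n)
    where
    go : ∀ i n → f (i ℕ.+ n) -ᵍ f n ≼ B ℚ.* Γ ℚ.* pow n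
    go zero    n = subst (_≼ B ℚ.* Γ ℚ.* pow n) (sym (𝔾-Ring.-‿inverseʳ (f n)))
      (0≼ (*-nonneg (*-nonneg 0≤B 0≤Γ) (0≤pow n)))
    go (suc i) n = subst₂ _≼_
      (solveᵍ 3 (λ a b c → (a ⊖ b) ⊕ (b ⊖ c) ≔ a ⊖ c)
        refl (f (suc i ℕ.+ n)) (f (suc n)) (f n))
      (trans
        (solve 4 (λ b c s p → b :* c :* (s :* p) :+ b :* p := b :* (con 1ℚ :+ s :* c) :* p) refl
          B Γ σ (pow n))
        (cong (λ u → B ℚ.* u ℚ.* pow n) (sym Γ≡1+σΓ)))
      (≼-+ (subst (λ m → f m -ᵍ f (suc n) ≼ B ℚ.* Γ ℚ.* pow (suc n)) (ℕ.+-suc i n) (go i (suc n)))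
        (step n))

  -- Bounds on coefficients and increments

  module _ {q : 𝔾} (q≼σ⁴ : q ≼ (σ ℚ.* σ) ℚ.* (σ ℚ.* σ)) where

    q^≼pow⁴ : ∀ n → q ^ᵍ n ≼ pow⁴ n
    q^≼pow⁴ zero    = 1≼1
    q^≼pow⁴ (suc n) = subst (q ^ᵍ suc n ≼_)
      (solve 2 (λ s p → (s :* s) :* (s :* s) :* ((p :* p) :* (p :* p))
          := ((s :* p) :* (s :* p)) :* ((s :* p) :* (s :* p))) refl σ (pow n))
      (≼-* q≼σ⁴ (q^≼pow⁴ n))

    q^1+n≼σ : ∀ n → q ^ᵍ suc n ≼ σ
    q^1+n≼σ n = ≼-weaken (q^≼pow⁴ (suc n)) (ℚ.≤-trans (pow⁴≤pow (suc n))
      (subst (σ ℚ.* pow n ℚ.≤_) (ℚ.*-identityʳ σ) (*-monoˡ-≤ (ℚ.<⇒≤ 0<σ) (pow≤1 n))))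

    ∥1-q^1+n∥²≥ : ∀ n → (1ℚ ℚ.- σ) ℚ.* (1ℚ ℚ.- σ) ℚ.≤ ∥ 1ᵍ -ᵍ q ^ᵍ suc n ∥²
    ∥1-q^1+n∥²≥ n = ∥1-z∥²≥ (q^1+n≼σ n) (ℚ.<⇒≤ σ<1)

    -- Here |1 - q^(n+1)| ≥ 1 - σ = 1/Γ, so dividing by this factor costs at most `Γ`.
    divide-≼ : ∀ n {z w b} → (1ᵍ -ᵍ q ^ᵍ suc n) *ᵍ z ≡ w → w ≼ b → z ≼ Γ ℚ.* b
    divide-≼ n {z} {w} {b} eq (0≤b ⊣ w≤b) = *-nonneg 0≤Γ 0≤b ⊣ subst₂ ℚ._≤_
      (trans
        (solve 3 (λ d c z → (c :* c) :* (d :* d :* z) := (d :* c) :* (d :* c) :* z) refl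
          (1ℚ ℚ.- σ) Γ ∥ z ∥²)
        (trans (cong (λ u → u ℚ.* u ℚ.* ∥ z ∥²) (recip-inverse 0<1-σ)) (ℚ.*-identityˡ ∥ z ∥²)))
      (solve 2 (λ c b → (c :* c) :* (b :* b) := (c :* b) :* (c :* b)) refl Γ b)
      (*-monoˡ-≤ (*-nonneg 0≤Γ 0≤Γ)
        (ℚ.≤-trans (*-monoʳ-≤ (0≤∥z∥² z) (∥1-q^1+n∥²≥ n))
          (ℚ.≤-trans (ℚ.≤-reflexive (trans (sym (∥zw∥² (1ᵍ -ᵍ q ^ᵍ suc n) z)) (cong ∥_∥² eq))) w≤b)))

    -- Feeds `coeff-ratio` into `majorant` with b = 0. Since k ≤ n, the term q^n is absorbed by
    -- σ^(4n) ≤ σ^(4k), which makes the bound uniform in `n`.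
    coeff-≼ : ∀ {n k} → k ≤ n → coeff q n k ≼ K₀
    coeff-≼ {n} {k} k≤n = ≼-weaken (go k k≤n) (majorant≤K₀ k)
      where
      go : ∀ k → k ≤ n → coeff q n k ≼ majorant 0ℚ k
      go zero    _   = 1≼1
      go (suc k) k<n = divide-≼ k (coeff-ratio q n k)
        (≼-neg (subst ((q ^ᵍ k -ᵍ q ^ᵍ n) *ᵍ coeff q n k ≼_) (sym (ℚ.+-identityʳ _))
          (≼-*
            (≼-weaken (≼-- (q^≼pow⁴ k) (q^≼pow⁴ n))
              (ℚ.+-monoʳ-≤ (pow⁴ k) (pow⁴-antitone (ℕ.<⇒≤ k<n))))
            (go k (ℕ.<⇒≤ k<n)))))

    -- By `moment₁` this is, up to sign, a sum of n + 2 terms k c(n+1,k), each at most (n + 2) K₀.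
    -- Quadratic growth is harmless next to the factor q^(n+1) of the increments.
    qFac-≼ : ∀ n → qFac q n ≼ ι (suc (suc n)) ℚ.* (ι (suc (suc n)) ℚ.* K₀)
    qFac-≼ n = subst (_≼ ι (suc (suc n)) ℚ.* (ι (suc (suc n)) ℚ.* K₀))
      (trans (cong -ᵍ_ (moment₁ q n)) (neg-involutive (qFac q n)))
      (≼-neg (≼-∑ (suc (suc n)) (*-nonneg (0≤ι (suc (suc n))) 0≤K₀) λ { k k<2+n@(s≤s k≤1+n) →
        ≼-weaken (≼-· k (coeff-≼ k≤1+n)) (*-monoʳ-≤ 0≤K₀ (ι-mono (ℕ.<⇒≤ k<2+n))) }))
      where
      neg-involutive : ∀ z → -ᵍ (-ᵍ z) ≡ z
      neg-involutive = solveᵍ 1 (λ z → ⊝ (⊝ z) ≔ z) refl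

    qFac-step : ∀ n → qFac q (suc n) -ᵍ qFac q n ≼ K₀ ℚ.* cube (1ℚ ℚ.+ Γ) ℚ.* pow n
    qFac-step n = subst (_≼ K₀ ℚ.* cube (1ℚ ℚ.+ Γ) ℚ.* pow n)
      (trans
        (solveᵍ 2 (λ x p → ⊝ (x ⊗ p)
            ≔ p ⊗ (conᵍ 1ᵍ ⊖ x) ⊖ p)
          refl (q ^ᵍ suc n) (qFac q n))
        (cong (_-ᵍ qFac q n) (sym (qFac-suc q n))))
      (≼-weaken (≼-neg (≼-* (q^≼pow⁴ (suc n)) (qFac-≼ n)))
        (subst₂ ℚ._≤_
          (solve 3 (λ k N p → k :* (con 1ℚ :* (N :* N) :* p) := p :* (N :* (N :* k))) refl
            K₀ N (pow⁴ (suc n)))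
          (sym (ℚ.*-assoc K₀ (cube (1ℚ ℚ.+ Γ)) (pow n)))
          -- A factor 1 ≤ n + 2 raises the quadratic bound to a cubic one, so that `cube-pow⁴`
          -- applies.
          (*-monoˡ-≤ 0≤K₀ (ℚ.≤-trans
            (*-monoʳ-≤ (0≤pow⁴ (suc n)) (*-monoʳ-≤ (*-nonneg 0≤N 0≤N) (p≤p+r {1ℚ} (0≤ι (suc n)))))
            (cube-pow⁴ n)))))
      where
      N = ι (suc (suc n))
      0≤N = 0≤ι (suc (suc n))

    module _ {h : ℕ → 𝔾} (h-eq : ∀ k → (1ᵍ -ᵍ q ^ᵍ suc k) *ᵍ h k ≡ q ^ᵍ suc k) where

      h-≼ : ∀ k → h k ≼ Γ ℚ.* pow k
      h-≼ k = ≼-weaken (divide-≼ k (h-eq k) (q^≼pow⁴ (suc k)))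
        (*-monoˡ-≤ 0≤Γ (ℚ.≤-trans (pow⁴≤pow (suc k)) (σ*-≤ (0≤pow k))))

      ∑h-step : ∀ n → ∑ᵍ (suc n) h -ᵍ ∑ᵍ n h ≼ Γ ℚ.* pow n
      ∑h-step n = subst (_≼ Γ ℚ.* pow n)
        (trans
          (solveᵍ 2 (λ s a → a ≔ s ⊕ a ⊖ s) refl (∑ᵍ n h) (h n))
          (cong (_-ᵍ ∑ᵍ n h) (sym (∑ᵍ-last n h))))
        (h-≼ n)

      1-∑h-≼ : ∀ n → 1ᵍ -ᵍ ∑ᵍ n h ≼ ι (suc (suc n)) ℚ.* (1ℚ ℚ.+ Γ)
      1-∑h-≼ n = ≼-weaken
        (≼-- 1≼1 (≼-∑ n {b = Γ} 0≤Γ λ k _ →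
          ≼-weaken (h-≼ k) (subst (Γ ℚ.* pow k ℚ.≤_) (ℚ.*-identityʳ Γ) (*-monoˡ-≤ 0≤Γ (pow≤1 k)))))
        (subst (1ℚ ℚ.+ ι n ℚ.* Γ ℚ.≤_)
          (solve 2 (λ n c → con 1ℚ :+ n :* c :+ (con 1ℚ :+ (c :+ c) :+ n)
              := (con 1ℚ :+ (con 1ℚ :+ n)) :* (con 1ℚ :+ c)) refl (ι n) Γ)
          (p≤p+r (+-nonneg (+-nonneg 0≤1 (+-nonneg 0≤Γ 0≤Γ)) (0≤ι n))))

      -- By `h-eq` the increment equals q^(n+1) (q;q)_n (1 - ∑ h), whose factors are bounded by
      -- σ^(4n+4), by order n² and by order n.
      qFac∑h-step : ∀ n → qFac q (suc n) *ᵍ ∑ᵍ (suc n) h -ᵍ qFac q n *ᵍ ∑ᵍ n h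
        ≼ K₀ ℚ.* (1ℚ ℚ.+ Γ) ℚ.* cube (1ℚ ℚ.+ Γ) ℚ.* pow n
      qFac∑h-step n = subst (_≼ K₀ ℚ.* (1ℚ ℚ.+ Γ) ℚ.* cube (1ℚ ℚ.+ Γ) ℚ.* pow n) eq
        (≼-weaken (≼-* (q^≼pow⁴ (suc n)) (≼-* (qFac-≼ n) (1-∑h-≼ n)))
          (subst₂ ℚ._≤_
            (solve 4 (λ k g N p → k :* g :* (N :* (N :* N) :* p) := p :* (N :* (N :* k) :* (N :* g)))
              refl K₀ (1ℚ ℚ.+ Γ) (ι (suc (suc n))) (pow⁴ (suc n)))
            (sym (ℚ.*-assoc (K₀ ℚ.* (1ℚ ℚ.+ Γ)) (cube (1ℚ ℚ.+ Γ)) (pow n)))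
            (*-monoˡ-≤ (*-nonneg 0≤K₀ (+-nonneg 0≤1 0≤Γ)) (cube-pow⁴ n))))
        where
        x = q ^ᵍ suc n
        P = qFac q n
        H = ∑ᵍ n h
        eq : x *ᵍ (P *ᵍ (1ᵍ -ᵍ H)) ≡ qFac q (suc n) *ᵍ ∑ᵍ (suc n) h -ᵍ P *ᵍ H
        eq = begin
          x *ᵍ (P *ᵍ (1ᵍ -ᵍ H))
            ≡⟨ solveᵍ 3 (λ x P H → x ⊗ (P ⊗ (conᵍ 1ᵍ ⊖ H))
                  ≔ P ⊗ (conᵍ 1ᵍ ⊖ x) ⊗ H
                    ⊕ P ⊗ x ⊖ P ⊗ H)
                refl x P H ⟩
          P *ᵍ (1ᵍ -ᵍ x) *ᵍ H +ᵍ P *ᵍ x -ᵍ P *ᵍ H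
            ≡⟨ cong (λ u → P *ᵍ (1ᵍ -ᵍ x) *ᵍ H +ᵍ P *ᵍ u -ᵍ P *ᵍ H) (sym (h-eq n)) ⟩
          P *ᵍ (1ᵍ -ᵍ x) *ᵍ H +ᵍ P *ᵍ ((1ᵍ -ᵍ x) *ᵍ h n) -ᵍ P *ᵍ H
            ≡⟨ cong (_-ᵍ P *ᵍ H) (solveᵍ 4 (λ P t H a →
                  P ⊗ t ⊗ H ⊕ P ⊗ (t ⊗ a)
                  ≔ P ⊗ t ⊗ (H ⊕ a))
                refl P (1ᵍ -ᵍ x) H (h n)) ⟩
          P *ᵍ (1ᵍ -ᵍ x) *ᵍ (H +ᵍ h n) -ᵍ P *ᵍ H
            ≡⟨ cong₂ (λ u v → u *ᵍ v -ᵍ P *ᵍ H) (sym (qFac-suc q n)) (sym (∑ᵍ-last n h)) ⟩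
          qFac q (suc n) *ᵍ ∑ᵍ (suc n) h -ᵍ P *ᵍ H ∎
          where open ≡-Reasoning

      module _ {e : ℕ → 𝔾} (e₀ : e 0 ≡ 1ᵍ)
        (e-ratio : ∀ k → (1ᵍ -ᵍ q ^ᵍ suc k) *ᵍ e (suc k) ≡ -ᵍ (q ^ᵍ k *ᵍ e k)) where

        -- The error d(k) = e(k) - c(n,k) satisfies (1 - q^(k+1)) d(k+1) = -q^k d(k) - q^n c(n,k)
        -- with d(0) = 0. The inhomogeneous term is at most K₀ σ^(4n), whence the `majorant` with b
        -- = K₀, scaled by σ^(4n).
        e-coeff-≼ : ∀ {n k} → k ≤ n → e k -ᵍ coeff q n k ≼ K₁ ℚ.* pow⁴ n
        e-coeff-≼ {n} {k} k≤n = ≼-weaken (go k k≤n)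
          (*-monoʳ-≤ (0≤pow⁴ n) (majorant≤K₁ k))
          where
          go : ∀ k → k ≤ n → e k -ᵍ coeff q n k ≼ majorant K₀ k ℚ.* pow⁴ n
          go zero _ = subst (_≼ 1ℚ ℚ.* pow⁴ n) (cong (_-ᵍ 1ᵍ) (sym e₀))
            (0≼ (*-nonneg 0≤1 (0≤pow⁴ n)))
          go (suc k) k<n = subst (e (suc k) -ᵍ coeff q n (suc k) ≼_)
            (sym (ℚ.*-assoc Γ _ (pow⁴ n)))
            (divide-≼ k eq
              (≼-weaken
                (≼-- (≼-neg (≼-* (q^≼pow⁴ k) (go k (ℕ.<⇒≤ k<n))))
                  (≼-* (q^≼pow⁴ n) (coeff-≼ (ℕ.<⇒≤ k<n))))
                (subst₂ ℚ._≤_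
                  (solve 4 (λ a m t b → (a :* m :+ b) :* t := a :* (m :* t) :+ t :* b) refl
                    (pow⁴ k) (majorant K₀ k) (pow⁴ n) K₀)
                  refl
                  (*-monoʳ-≤ (0≤pow⁴ n) (ℚ.+-monoˡ-≤ K₀
                    -- The single σ^(4k) is doubled to fit the recursion of `majorant`.
                    (*-monoʳ-≤ (0≤majorant 0≤K₀ k) (p≤p+r {pow⁴ k} (0≤pow⁴ k))))))))
            where
            eq : (1ᵍ -ᵍ q ^ᵍ suc k) *ᵍ (e (suc k) -ᵍ coeff q n (suc k)) ≡
              -ᵍ (q ^ᵍ k *ᵍ (e k -ᵍ coeff q n k)) -ᵍ q ^ᵍ n *ᵍ coeff q n k
            eq = trans
              (solveᵍ 3 (λ t a b → t ⊗ (a ⊖ b)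
                  ≔ t ⊗ a ⊖ t ⊗ b)
                refl (1ᵍ -ᵍ q ^ᵍ suc k) (e (suc k)) (coeff q n (suc k)))
              (trans (cong₂ _-ᵍ_ (e-ratio k) (coeff-ratio q n k))
                (solveᵍ 4 (λ x y a b →
                    ⊝ (x ⊗ a)
                      ⊖ (⊝ ((x ⊖ y) ⊗ b))
                    ≔ ⊝ (x ⊗ (a ⊖ b))
                      ⊖ y ⊗ b)
                  refl (q ^ᵍ k) (q ^ᵍ n) (e k) (coeff q n k)))

        -- The n + 2 terms cover the whole row n + 1, whose moment `moment₂` evaluates exactly. What
        -- remains is n + 2 errors, each weighted by (k choose 2) ≤ (n + 2)².
        ∑e-≼ : ∀ n → ∑ᵍ (suc (suc n)) (λ k → (k C 2) ·ᵍ e k) -ᵍ qFac q n *ᵍ ∑ᵍ n h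
          ≼ K₁ ℚ.* cube (1ℚ ℚ.+ Γ) ℚ.* pow n
        ∑e-≼ n = subst (_≼ K₁ ℚ.* cube (1ℚ ℚ.+ Γ) ℚ.* pow n) eq
          (≼-weaken
            (≼-∑ (suc (suc n)) (*-nonneg (*-nonneg 0≤N 0≤N) (*-nonneg 0≤K₁ (0≤pow⁴ (suc n))))
              λ { k k<2+n@(s≤s k≤1+n) → ≼-weaken (≼-· (k C 2) (e-coeff-≼ k≤1+n))
                (*-monoʳ-≤ (*-nonneg 0≤K₁ (0≤pow⁴ (suc n)))
                  (ℚ.≤-trans (ιC2≤ι² k)
                    (*-mono-≤ (0≤ι k) (0≤ι k) (ι-mono (ℕ.<⇒≤ k<2+n)) (ι-mono (ℕ.<⇒≤ k<2+n))))) })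
            (subst₂ ℚ._≤_
              (solve 3 (λ k N p → k :* (N :* (N :* N) :* p) := N :* (N :* N :* (k :* p))) refl
                K₁ N (pow⁴ (suc n)))
              (sym (ℚ.*-assoc K₁ (cube (1ℚ ℚ.+ Γ)) (pow n)))
              (*-monoˡ-≤ 0≤K₁ (cube-pow⁴ n))))
          where
          N = ι (suc (suc n))
          0≤N = 0≤ι (suc (suc n))
          c = coeff q (suc n)
          diff : ℕ → 𝔾
          diff k = (k C 2) ·ᵍ (e k -ᵍ c k)
          term : ∀ k → (k C 2) ·ᵍ e k ≡ diff k +ᵍ (k C 2) ·ᵍ c k
          term k = trans (·ᵍ≡* (k C 2) (e k))
            (trans
              (solveᵍ 3 (λ m a b → m ⊗ a
                  ≔ m ⊗ (a ⊖ b) ⊕ m ⊗ b)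
                refl ((k C 2) ·ᵍ 1ᵍ) (e k) (c k))
              (sym (cong₂ _+ᵍ_ (·ᵍ≡* (k C 2) (e k -ᵍ c k)) (·ᵍ≡* (k C 2) (c k)))))
          eq : ∑ᵍ (suc (suc n)) diff ≡
            ∑ᵍ (suc (suc n)) (λ k → (k C 2) ·ᵍ e k) -ᵍ qFac q n *ᵍ ∑ᵍ n h
          eq = trans
            (solveᵍ 2 (λ a b → a ≔ a ⊕ b ⊖ b) refl
              (∑ᵍ (suc (suc n)) diff) (moment q (_C 2) (suc n)))
            (cong₂ _-ᵍ_
              (sym (trans (∑ᵍ-cong (suc (suc n)) term)
                (∑ᵍ-+ (suc (suc n)) diff λ k → (k C 2) ·ᵍ c k)))
              (moment₂ q h h-eq n))

-- Complex numbers and limits through their rational approximations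

-- The ring operations and division of `ℂ` act termwise on approximations, so `at` commutes with
-- them by definition and identities over `𝔾` pass to `ℂ`.
at : ℂ → ℕ → 𝔾
at z i = seq (re z) i +𝕚 seq (im z) i

at-^ : ∀ z n i → at (z ^ n) i ≡ at z i ^ᵍ n
at-^ z zero    i = refl
at-^ z (suc n) i = cong (at z i *ᵍ_) (at-^ z n i)

at-· : ∀ n z i → at (n · z) i ≡ n ·ᵍ at z i
at-· zero    z i = refl
at-· (suc n) z i = cong (at z i +ᵍ_) (at-· n z i)

at-∑ : ∀ n f i → at (∑< n f) i ≡ ∑ᵍ n λ k → at (f k) i
at-∑ zero    f i = refl
at-∑ (suc n) f i = cong (at (f 0) i +ᵍ_) (at-∑ n (λ k → f (suc k)) i)

at-∏ : ∀ n f i → at (∏< n f) i ≡ ∏ᵍ n λ k → at (f k) i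
at-∏ zero    f i = refl
at-∏ (suc n) f i = cong (at (f 0) i *ᵍ_) (at-∏ n (λ k → f (suc k)) i)

at-qFac : ∀ q n i → at (⟨ q ⨾ q ⟩ n) i ≡ qFac (at q i) n
at-qFac q n i = trans (at-∏ n (λ j → 1# - q * q ^ j) i)
  (∏ᵍ-cong n λ j → cong (λ u → 1ᵍ -ᵍ at q i *ᵍ u) (at-^ q j i))

≈-pointwise : ∀ {z w} → Eventually (λ i → at z i ≡ at w i) → z ≈ w
≈-pointwise {z} {w} (N , eq) = part reᵍ , part imᵍ
  where
  part : (p : 𝔾 → ℚ) → ∀ ε → 0ℚ ℚ.< ε → Eventually λ i → ℚ.∣ p (at z i) ℚ.- p (at w i) ∣ ℚ.< ε
  part p ε 0<ε = N , λ i N≤i → subst (ℚ._< ε)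
    (sym (cong ℚ.∣_∣ (trans (cong (λ u → p u ℚ.- p (at w i)) (eq i N≤i)) (ℚ.+-inverseʳ (p (at w i))))))
    0<ε

≈-refl : ∀ z → z ≈ z
≈-refl z = ≈-pointwise {z} {z} (0 , λ _ _ → refl)

-- Convergence at a given rate and diagonal limits

Null : (ℕ → ℚ) → Set
Null b = ∀ {ε} → 0ℚ ℚ.< ε → Eventually λ n → b n ℚ.< ε

-- The precision `i` from which the bound holds may depend on `n`, which lets `l` be a diagonal
-- limit.
⟶-bound : ∀ {s l b} → Null b → (∀ n → Eventually λ i → at (s n) i -ᵍ at l i ≼ b n) → s ⟶ l
⟶-bound {s} {l} {b} b-null s-l≼b ε 0<ε@(δ , 0<δ , M , δ<ε) =
  let N , b<δ/2 = b-null 0<δ/2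
  -- Once |s - l| ≤ δ/2, its square plus the gap (δ/2)² is at most δ², hence below ε², because ε
  -- eventually exceeds δ.
  in N , λ n N≤n → 0<ε , ½δ ℚ.* ½δ , *-pos 0<δ/2 0<δ/2 ,
    both (λ {i} δ<ε s-l≼b → ℚ.≤-<-trans
        (ℚ.≤-trans (ℚ.+-monoˡ-≤ (½δ ℚ.* ½δ) (∥∥²≤bound² (≼-weaken s-l≼b (ℚ.<⇒≤ (b<δ/2 n N≤n)))))
          (p≤p+r (+-nonneg 0≤½δ² 0≤½δ²)))
        (subst (ℚ._< seq ε i ℚ.* seq ε i)
          (solve 1 (λ d → (con 0ℚ :+ d) :* (con 0ℚ :+ d)
              := (con ½ :* d) :* (con ½ :* d) :+ (con ½ :* d) :* (con ½ :* d)
                :+ ((con ½ :* d) :* (con ½ :* d) :+ (con ½ :* d) :* (con ½ :* d))) refl δ)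
          (*-mono-< 0≤0+δ 0≤0+δ δ<ε δ<ε)))
      (M , δ<ε) (s-l≼b n)
  where
  ½δ = ½ ℚ.* δ
  0<δ/2 = *-pos (ℚ.positive⁻¹ ½) 0<δ
  0≤½δ² : 0ℚ ℚ.≤ ½δ ℚ.* ½δ
  0≤½δ² = square-nonneg ½δ
  0≤0+δ : 0ℚ ℚ.≤ 0ℚ ℚ.+ δ
  0≤0+δ = +-nonneg ℚ.≤-refl (ℚ.<⇒≤ 0<δ)

⟶-unshift : ∀ {s l} → (λ n → s (suc (suc n))) ⟶ l → s ⟶ l
⟶-unshift s⟶l ε 0<ε with s⟶l ε 0<ε
... | N , close = suc (suc N) , λ { (suc (suc n)) (s≤s (s≤s N≤n)) → close n N≤n }

∣_∣≤ : ∀ p {b} → 0ℚ ℚ.≤ b → p ℚ.* p ℚ.≤ b ℚ.* b → ℚ.∣ p ∣ ℚ.≤ b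
∣ p ∣≤ {b} 0≤b p²≤b² = square-cancel-≤ 0≤b
  (subst (ℚ._≤ b ℚ.* b)
    (trans (sym (ℚ.0≤p⇒∣p∣≡p (square-nonneg p))) (ℚ.∣p*q∣≡∣p∣*∣q∣ p p)) p²≤b²)

-- Two diagonal entries are compared through one fixed `s N`: uniform closeness moves each of them
-- to it at its own precision, and `s N` is Cauchy.
diagonal-cauchy : ∀ (s : ℕ → ℝ) {b N₀} → Null b →
  (∀ i → N₀ ≤ i → ∀ {n m} → n ≤ m → ℚ.∣ seq (s m) i ℚ.- seq (s n) i ∣ ℚ.≤ b n) →
  IsCauchy λ i → seq (s i) i
diagonal-cauchy s {b} {N₀} b-null close ε 0<ε =
  let N , b<η = b-null 0<η
      M , cauchy-N = cauchy (s N) η 0<η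
      K = N₀ ℕ.⊔ (N ℕ.⊔ M)
      N₀≤ : ∀ {i} → K ≤ i → N₀ ≤ i
      N₀≤ = ℕ.≤-trans (ℕ.m≤m⊔n N₀ (N ℕ.⊔ M))
      N≤ : ∀ {i} → K ≤ i → N ≤ i
      N≤ = ℕ.≤-trans (ℕ.≤-trans (ℕ.m≤m⊔n N M) (ℕ.m≤n⊔m N₀ (N ℕ.⊔ M)))
      M≤ : ∀ {i} → K ≤ i → M ≤ i
      M≤ = ℕ.≤-trans (ℕ.≤-trans (ℕ.m≤n⊔m N M) (ℕ.m≤n⊔m N₀ (N ℕ.⊔ M)))
      near : ∀ i → K ≤ i → ℚ.∣ seq (s i) i ℚ.- seq (s N) i ∣ ℚ.< η
      near = λ i i≥ → ℚ.≤-<-trans (close i (N₀≤ i≥) (N≤ i≥)) (b<η N ℕ.≤-refl)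
  in K , λ m n m≥ n≥ →
    let x = seq (s m) m ; y = seq (s N) m ; z = seq (s N) n ; w = seq (s n) n
    in ℚ.≤-<-trans
      (subst (λ t → ℚ.∣ t ∣ ℚ.≤ ℚ.∣ x ℚ.- y ∣ ℚ.+ (ℚ.∣ y ℚ.- z ∣ ℚ.+ ℚ.∣ w ℚ.- z ∣))
        (solve 4 (λ x y z w → (x :- y) :+ ((y :- z) :- (w :- z)) := x :- w) refl x y z w)
        (ℚ.≤-trans (ℚ.∣p+q∣≤∣p∣+∣q∣ (x ℚ.- y) ((y ℚ.- z) ℚ.- (w ℚ.- z)))
          (ℚ.+-monoʳ-≤ ℚ.∣ x ℚ.- y ∣ (ℚ.∣p-q∣≤∣p∣+∣q∣ (y ℚ.- z) (w ℚ.- z)))))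
      (ℚ.<-≤-trans
        (ℚ.+-mono-< (near m m≥) (ℚ.+-mono-< (cauchy-N m n (M≤ m≥) (M≤ n≥)) (near n n≥)))
        (subst (η ℚ.+ (η ℚ.+ η) ℚ.≤_)
          (solve 1 (λ e → con ½ :* (con ½ :* e) :+ (con ½ :* (con ½ :* e) :+ con ½ :* (con ½ :* e))
              :+ con ½ :* (con ½ :* e) := e) refl ε)
          (p≤p+r (ℚ.<⇒≤ 0<η))))
  where
  -- Three distances below ε/4 stay under ε.
  η = ½ ℚ.* (½ ℚ.* ε)
  0<η = *-pos (ℚ.positive⁻¹ ½) (*-pos (ℚ.positive⁻¹ ½) 0<ε)

module _ {f : ℕ → ℂ} {b N₀} (b-null : Null b)
  (close : ∀ i → N₀ ≤ i → ∀ {n m} → n ≤ m → at (f m) i -ᵍ at (f n) i ≼ b n) where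

  diagonal : ℂ
  diagonal =
    mkℝ (λ i → seq (re (f i)) i)
      (diagonal-cauchy (λ n → re (f n)) b-null λ i i≥ n≤m → ∣re∣ (close i i≥ n≤m))
    +i
    mkℝ (λ i → seq (im (f i)) i)
      (diagonal-cauchy (λ n → im (f n)) b-null λ i i≥ n≤m → ∣im∣ (close i i≥ n≤m))
    where
    ∣re∣ : ∀ {x y c} → (x +𝕚 y) ≼ c → ℚ.∣ x ∣ ℚ.≤ c
    ∣re∣ {x} {y} (0≤c ⊣ z≤c) = ∣ x ∣≤ 0≤c (ℚ.≤-trans (p≤p+r (square-nonneg y)) z≤c)
    ∣im∣ : ∀ {x y c} → (x +𝕚 y) ≼ c → ℚ.∣ y ∣ ℚ.≤ c
    ∣im∣ {x} {y} (0≤c ⊣ z≤c) = ∣ y ∣≤ 0≤c (ℚ.≤-trans (p≤r+p (square-nonneg x)) z≤c)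

  -- The i-th approximation of the limit is that of `f i`, so for i ≥ n the hypothesis `close`
  -- compares it with `f n` directly.
  ⟶-diagonal : f ⟶ diagonal
  ⟶-diagonal = ⟶-bound {f} {diagonal} b-null λ n → N₀ ℕ.⊔ n , λ i i≥ → subst (_≼ b n)
    (solveᵍ 2 (λ x y → ⊝ (x ⊖ y) ≔ y ⊖ x) refl
      (at (f i) i) (at (f n) i))
    (≼-neg (close i (ℕ.≤-trans (ℕ.m≤m⊔n N₀ n) i≥) (ℕ.≤-trans (ℕ.m≤n⊔m N₀ n) i≥)))

1-2x≤[1-x]² : ∀ x → 1ℚ ℚ.- (x ℚ.+ x) ℚ.≤ (1ℚ ℚ.- x) ℚ.* (1ℚ ℚ.- x)
1-2x≤[1-x]² x = subst (1ℚ ℚ.- (x ℚ.+ x) ℚ.≤_)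
  (solve 1 (λ x → con 1ℚ :- (x :+ x) :+ x :* x := (con 1ℚ :- x) :* (con 1ℚ :- x)) refl x)
  (p≤p+r (square-nonneg x))

-- 1 - δ ≤ (1 - δ/2)² ≤ (1 - δ/4)⁴ ≤ (1 - δ/8)⁸, and |q|² ≤ 1 - δ.
∣q∣≤σ⁴ : ∀ q → ∣ q ∣< 1ᵣ → ∃ λ σ → 0ℚ ℚ.< σ × σ ℚ.< 1ℚ ×
  Eventually λ i → at q i ≼ (σ ℚ.* σ) ℚ.* (σ ℚ.* σ)
∣q∣≤σ⁴ q (_ , δ , 0<δ , N , q²+δ<1) =
  1ℚ ℚ.- c ,
  ℚ.<-≤-trans 0<1-δ
    (ℚ.≤-trans (1-2x≤1-x δ 0<a) (ℚ.≤-trans (1-2x≤1-x a 0<b) (1-2x≤1-x b 0<c))) ,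
  subst (1ℚ ℚ.- c ℚ.<_) (ℚ.+-identityʳ 1ℚ) (ℚ.+-monoʳ-< 1ℚ (ℚ.neg-antimono-< 0<c)) ,
  N , λ i N≤i → *-nonneg (square-nonneg (1ℚ ℚ.- c)) (square-nonneg (1ℚ ℚ.- c)) ⊣
    ℚ.≤-trans (q²≤1-δ i N≤i) 1-δ≤σ⁸
  where
  a = ½ ℚ.* δ
  b = ½ ℚ.* a
  c = ½ ℚ.* b
  double-half : ∀ x → ½ ℚ.* x ℚ.+ ½ ℚ.* x ≡ x
  double-half = solve 1 (λ x → con ½ :* x :+ con ½ :* x := x) refl
  0<a = *-pos (ℚ.positive⁻¹ ½) 0<δ
  0<b = *-pos (ℚ.positive⁻¹ ½) 0<a
  0<c = *-pos (ℚ.positive⁻¹ ½) 0<b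
  q²≤1-δ : ∀ i → N ≤ i → ∥ at q i ∥² ℚ.≤ 1ℚ ℚ.- δ
  q²≤1-δ i N≤i = subst (ℚ._≤ 1ℚ ℚ.- δ)
    (solve 2 (λ x d → x :+ d :- d := x) refl ∥ at q i ∥² δ)
    (ℚ.+-monoˡ-≤ (ℚ.- δ) (ℚ.<⇒≤ (q²+δ<1 i N≤i)))
  0<1-δ : 0ℚ ℚ.< 1ℚ ℚ.- δ
  0<1-δ = subst (ℚ._< 1ℚ ℚ.- δ) (ℚ.+-inverseʳ δ) (ℚ.+-monoˡ-< (ℚ.- δ)
    (ℚ.≤-<-trans (p≤r+p (0≤∥z∥² (at q N))) (q²+δ<1 N ℕ.≤-refl)))
  1-2x≤1-x : ∀ x → 0ℚ ℚ.< ½ ℚ.* x → 1ℚ ℚ.- x ℚ.≤ 1ℚ ℚ.- ½ ℚ.* x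
  1-2x≤1-x x 0<½x = ℚ.+-monoʳ-≤ 1ℚ (ℚ.neg-antimono-≤
    (subst (½ ℚ.* x ℚ.≤_) (double-half x) (p≤p+r (ℚ.<⇒≤ 0<½x))))
  square : ∀ x → 1ℚ ℚ.- x ℚ.≤ (1ℚ ℚ.- ½ ℚ.* x) ℚ.* (1ℚ ℚ.- ½ ℚ.* x)
  square x = subst (λ y → 1ℚ ℚ.- y ℚ.≤ (1ℚ ℚ.- ½ ℚ.* x) ℚ.* (1ℚ ℚ.- ½ ℚ.* x))
    (double-half x) (1-2x≤[1-x]² (½ ℚ.* x))
  0≤1-a = ℚ.≤-trans (ℚ.<⇒≤ 0<1-δ) (1-2x≤1-x δ 0<a)
  0≤1-b = ℚ.≤-trans 0≤1-a (1-2x≤1-x a 0<b)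
  1-a≤σ⁴ = ℚ.≤-trans (square a) (*-mono-≤ 0≤1-b 0≤1-b (square b) (square b))
  1-δ≤σ⁸ = ℚ.≤-trans (square δ) (*-mono-≤ 0≤1-a 0≤1-a 1-a≤σ⁴ 1-a≤σ⁴)

-- The two identities

lambert : 𝔾 → ℕ → 𝔾
lambert q k = q ^ᵍ suc k /ᵍ (1ᵍ -ᵍ q ^ᵍ suc k)

eulerCoeff : 𝔾 → ℕ → 𝔾
eulerCoeff q k = sign q k /ᵍ qFac q k

module _ {q : 𝔾} (0<∥1-q^∥² : ∀ n → 0ℚ ℚ.< ∥ 1ᵍ -ᵍ q ^ᵍ suc n ∥²) where

  0<∥qFac∥² : ∀ n → 0ℚ ℚ.< ∥ qFac q n ∥²
  0<∥qFac∥² zero    = ℚ.positive⁻¹ 1ℚ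
  0<∥qFac∥² (suc n) = subst (0ℚ ℚ.<_)
    (sym (trans (cong ∥_∥² (qFac-suc q n)) (∥zw∥² (qFac q n) (1ᵍ -ᵍ q ^ᵍ suc n))))
    (*-pos (0<∥qFac∥² n) (0<∥1-q^∥² n))

  lambert-eq : ∀ k → (1ᵍ -ᵍ q ^ᵍ suc k) *ᵍ lambert q k ≡ q ^ᵍ suc k
  lambert-eq k = /ᵍ-inverse (q ^ᵍ suc k) (0<∥1-q^∥² k)

  -- Multiplying by (q;q)_k reduces this to `sign-suc`. It is `coeff-ratio` with q^n replaced by its
  -- limit 0.
  eulerCoeff-ratio : ∀ k →
    (1ᵍ -ᵍ q ^ᵍ suc k) *ᵍ eulerCoeff q (suc k) ≡ -ᵍ (q ^ᵍ k *ᵍ eulerCoeff q k)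
  eulerCoeff-ratio k = *ᵍ-cancelˡ (0<∥qFac∥² k) (begin
    P *ᵍ ((1ᵍ -ᵍ q ^ᵍ suc k) *ᵍ eulerCoeff q (suc k))
      ≡⟨ sym (𝔾-Ring.*-assoc P _ _) ⟩
    P *ᵍ (1ᵍ -ᵍ q ^ᵍ suc k) *ᵍ eulerCoeff q (suc k)
      ≡⟨ cong (_*ᵍ eulerCoeff q (suc k)) (sym (qFac-suc q k)) ⟩
    qFac q (suc k) *ᵍ eulerCoeff q (suc k)
      ≡⟨ /ᵍ-inverse (sign q (suc k)) (0<∥qFac∥² (suc k)) ⟩
    sign q (suc k)
      ≡⟨ sign-suc q k ⟩
    -ᵍ (q ^ᵍ k *ᵍ sign q k)
      ≡⟨ cong (λ u → -ᵍ (q ^ᵍ k *ᵍ u)) (sym (/ᵍ-inverse (sign q k) (0<∥qFac∥² k))) ⟩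
    -ᵍ (q ^ᵍ k *ᵍ (P *ᵍ eulerCoeff q k))
      ≡⟨ solveᵍ 3 (λ x p e → ⊝ (x ⊗ (p ⊗ e)) ≔ p ⊗ (⊝ (x ⊗ e))) refl
          (q ^ᵍ k) P (eulerCoeff q k) ⟩
    P *ᵍ -ᵍ (q ^ᵍ k *ᵍ eulerCoeff q k) ∎)
    where
    open ≡-Reasoning
    P = qFac q k

  -- Multiplied by the denominator this is `qFac-coeff` with j = n - k. The factors are associated
  -- as in `finiteTerm`.
  qBinomial-sign : ∀ {n k} → k ≤ n →
    qFac q n /ᵍ (qFac q k *ᵍ qFac q (n ∸ k)) *ᵍ (-ᵍ 1ᵍ) ^ᵍ k *ᵍ q ^ᵍ (k C 2) ≡ coeff q n k
  qBinomial-sign {n} {k} k≤n = *ᵍ-cancelˡ 0<d (begin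
    d *ᵍ (qFac q n /ᵍ d *ᵍ (-ᵍ 1ᵍ) ^ᵍ k *ᵍ q ^ᵍ (k C 2))
      ≡⟨ solveᵍ 4 (λ d u x y → d ⊗ (u ⊗ x ⊗ y) ≔ d ⊗ u ⊗ (x ⊗ y)) refl
          d (qFac q n /ᵍ d) ((-ᵍ 1ᵍ) ^ᵍ k) (q ^ᵍ (k C 2)) ⟩
    d *ᵍ (qFac q n /ᵍ d) *ᵍ sign q k
      ≡⟨ cong (_*ᵍ sign q k) (/ᵍ-inverse (qFac q n) 0<d) ⟩
    qFac q n *ᵍ sign q k
      ≡⟨ cong (λ m → qFac q m *ᵍ sign q k) (sym (ℕ.m+[n∸m]≡n k≤n)) ⟩
    qFac q (k ℕ.+ (n ∸ k)) *ᵍ sign q k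
      ≡⟨ sym (qFac-coeff q k (n ∸ k)) ⟩
    d *ᵍ coeff q (k ℕ.+ (n ∸ k)) k
      ≡⟨ cong (λ m → d *ᵍ coeff q m k) (ℕ.m+[n∸m]≡n k≤n) ⟩
    d *ᵍ coeff q n k ∎)
    where
    open ≡-Reasoning
    d = qFac q k *ᵍ qFac q (n ∸ k)
    0<d : 0ℚ ℚ.< ∥ d ∥²
    0<d = subst (0ℚ ℚ.<_) (sym (∥zw∥² (qFac q k) (qFac q (n ∸ k))))
      (*-pos (0<∥qFac∥² k) (0<∥qFac∥² (n ∸ k)))

module _ (q : ℂ) (∣q∣<1 : ∣ q ∣< 1ᵣ) where

  private
    modulus = ∣q∣≤σ⁴ q ∣q∣<1
    σ = proj₁ modulus
    0<σ = proj₁ (proj₂ modulus)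
    σ<1 = proj₁ (proj₂ (proj₂ modulus))
    N₀ = proj₁ (proj₂ (proj₂ (proj₂ modulus)))
    open Geometric σ 0<σ σ<1

    q≼σ⁴ : ∀ {i} → N₀ ≤ i → at q i ≼ (σ ℚ.* σ) ℚ.* (σ ℚ.* σ)
    q≼σ⁴ {i} = proj₂ (proj₂ (proj₂ (proj₂ modulus))) i

    0<∥1-q^∥² : ∀ {i} → N₀ ≤ i → ∀ n → 0ℚ ℚ.< ∥ 1ᵍ -ᵍ at q i ^ᵍ suc n ∥²
    0<∥1-q^∥² i≥ n = ℚ.<-≤-trans (*-pos 0<1-σ 0<1-σ) (∥1-q^1+n∥²≥ (q≼σ⁴ i≥) n)

  finiteTerm : ℕ → ℕ → ℂ
  finiteTerm n k = qBinomial q ∣q∣<1 n k * (- 1#) ^ k * q ^ (k C 2)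

  eulerTerm : ℕ → ℂ
  eulerTerm k = (- 1#) ^ k * q ^ (k C 2) / ⟨ q ⨾ q ⟩ k [ 0<∣⟨q⨾q⟩∣ q k ∣q∣<1 ]

  lambertTerm : ℕ → ℂ
  lambertTerm k = q ^ suc k / (1# - q ^ suc k) [ 0<∣1-q^1+k∣ q k ∣q∣<1 ]

  -- Holds at every `i`, even where an approximate denominator vanishes, because both sides use the
  -- same total `recip`.
  at-lambert : ∀ n i → at (∑< n lambertTerm) i ≡ ∑ᵍ n (lambert (at q i))
  at-lambert n i = trans (at-∑ n lambertTerm i)
    (∑ᵍ-cong n λ k → cong (λ u → (at q i *ᵍ u) /ᵍ (1ᵍ -ᵍ at q i *ᵍ u)) (at-^ q k i))

  at-sign : ∀ k i → at ((- 1#) ^ k * q ^ (k C 2)) i ≡ sign (at q i) k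
  at-sign k i = cong₂ _*ᵍ_ (at-^ (- 1#) k i) (at-^ q (k C 2) i)

  at-eulerSum : ∀ n i →
    at (∑[ k < n ] ((k C 2) · eulerTerm k)) i ≡ ∑ᵍ n λ k → (k C 2) ·ᵍ eulerCoeff (at q i) k
  at-eulerSum n i = trans (at-∑ n (λ k → (k C 2) · eulerTerm k) i) (∑ᵍ-cong n λ k →
    trans (at-· (k C 2) (eulerTerm k) i)
      (cong ((k C 2) ·ᵍ_) (cong₂ _/ᵍ_ (at-sign k i) (at-qFac q k i))))

  -- From `N₀` on the approximations of `q` satisfy the bound σ⁴, so the denominators can be
  -- cancelled as `qBinomial-sign` requires.
  at-finiteSum : ∀ {i} → N₀ ≤ i → ∀ n →
    at (∑[ k < suc n ] ((k C 2) · finiteTerm n k)) i ≡ moment (at q i) (_C 2) n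
  at-finiteSum {i} i≥ n = trans (at-∑ (suc n) (λ k → (k C 2) · finiteTerm n k) i)
    (∑ᵍ-cong-< (suc n) λ { k (s≤s k≤n) →
      trans (at-· (k C 2) (finiteTerm n k) i) (cong ((k C 2) ·ᵍ_)
        (trans
          (cong₂ _*ᵍ_
            (cong₂ _*ᵍ_
              (cong₂ _/ᵍ_ (at-qFac q n i) (cong₂ _*ᵍ_ (at-qFac q k i) (at-qFac q (n ∸ k) i)))
              (at-^ (- 1#) k i))
            (at-^ q (k C 2) i))
          (qBinomial-sign (0<∥1-q^∥² i≥) k≤n))) })

  finite-identity : ∀ n →
    ∑[ k < suc (suc n) ] ((k C 2) · finiteTerm (suc n) k) ≈ ⟨ q ⨾ q ⟩ n * ∑< n lambertTerm
  finite-identity n = ≈-pointwise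
    {∑[ k < suc (suc n) ] ((k C 2) · finiteTerm (suc n) k)} {⟨ q ⨾ q ⟩ n * ∑< n lambertTerm}
    (N₀ , λ i i≥ → trans (at-finiteSum i≥ (suc n))
      (trans (moment₂ (at q i) (lambert (at q i)) (lambert-eq (0<∥1-q^∥² i≥)) n)
        (sym (cong₂ _*ᵍ_ (at-qFac q n i) (at-lambert n i)))))

  private
    null : ∀ {B} → 0ℚ ℚ.≤ B → Null λ n → B ℚ.* pow n
    null {B} 0≤B = pow-null B 0≤B

    0≤D : 0ℚ ℚ.≤ cube (1ℚ ℚ.+ Γ)
    0≤D = *-nonneg 0≤1+Γ (*-nonneg 0≤1+Γ 0≤1+Γ)
      where 0≤1+Γ = +-nonneg 0≤1 0≤Γ

    0≤B₁ : 0ℚ ℚ.≤ K₀ ℚ.* cube (1ℚ ℚ.+ Γ)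
    0≤B₁ = *-nonneg 0≤K₀ 0≤D

    0≤B₂ : 0ℚ ℚ.≤ K₀ ℚ.* (1ℚ ℚ.+ Γ) ℚ.* cube (1ℚ ℚ.+ Γ)
    0≤B₂ = *-nonneg (*-nonneg 0≤K₀ (+-nonneg 0≤1 0≤Γ)) 0≤D

    0≤B₃ : 0ℚ ℚ.≤ K₁ ℚ.* cube (1ℚ ℚ.+ Γ)
    0≤B₃ = *-nonneg 0≤K₁ 0≤D

    qFac-close : ∀ i → N₀ ≤ i → ∀ {n m} → n ≤ m →
      at (⟨ q ⨾ q ⟩ m) i -ᵍ at (⟨ q ⨾ q ⟩ n) i ≼ K₀ ℚ.* cube (1ℚ ℚ.+ Γ) ℚ.* Γ ℚ.* pow n
    qFac-close i i≥ {n} {m} n≤m = subst (_≼ K₀ ℚ.* cube (1ℚ ℚ.+ Γ) ℚ.* Γ ℚ.* pow n)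
      (sym (cong₂ _-ᵍ_ (at-qFac q m i) (at-qFac q n i)))
      (telescope (qFac (at q i)) 0≤B₁ (qFac-step (q≼σ⁴ i≥)) n≤m)

    lambert-close : ∀ i → N₀ ≤ i → ∀ {n m} → n ≤ m →
      at (∑< m lambertTerm) i -ᵍ at (∑< n lambertTerm) i ≼ Γ ℚ.* Γ ℚ.* pow n
    lambert-close i i≥ {n} {m} n≤m = subst (_≼ Γ ℚ.* Γ ℚ.* pow n)
      (sym (cong₂ _-ᵍ_ (at-lambert m i) (at-lambert n i)))
      (telescope (λ n → ∑ᵍ n (lambert (at q i))) 0≤Γ
        (∑h-step (q≼σ⁴ i≥) (lambert-eq (0<∥1-q^∥² i≥))) n≤m)

  P∞ T∞ : ℂ
  P∞ = diagonal {λ n → ⟨ q ⨾ q ⟩ n} (null (*-nonneg 0≤B₁ 0≤Γ)) qFac-close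
  T∞ = diagonal {λ n → ∑< n lambertTerm} (null (*-nonneg 0≤Γ 0≤Γ)) lambert-close

  P∞-limit : ⟨ q ⨾ q ⟩∞≡ P∞
  P∞-limit = ⟶-diagonal {λ n → ⟨ q ⨾ q ⟩ n} (null (*-nonneg 0≤B₁ 0≤Γ)) qFac-close

  T∞-limit : ∑∞ lambertTerm ≡ T∞
  T∞-limit = ⟶-diagonal {λ n → ∑< n lambertTerm} (null (*-nonneg 0≤Γ 0≤Γ)) lambert-close

  -- At precision i the product of the limits is exactly (q;q)_i times the sum of the first i
  -- Lambert terms. For i ≥ n the distance of a partial sum to it splits at the n-th such product:
  -- `∑e-≼` bounds one part and `telescope` the other.
  infinite-sum : ∑∞ (λ k → (k C 2) · eulerTerm k) ≡ (P∞ * T∞)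
  -- `∑e-≼` speaks of the first n + 2 terms, hence the shift by two.
  infinite-sum = ⟶-unshift {eulerSum} {P∞ * T∞}
    (⟶-bound {λ n → eulerSum (suc (suc n))} {P∞ * T∞} (null 0≤B) λ n →
      N₀ ℕ.⊔ n , λ i i≥ → bound n i (ℕ.≤-trans (ℕ.m≤m⊔n N₀ n) i≥) (ℕ.≤-trans (ℕ.m≤n⊔m N₀ n) i≥))
    where
    eulerSum : ℕ → ℂ
    eulerSum n = ∑[ k < n ] ((k C 2) · eulerTerm k)
    B₂ = K₀ ℚ.* (1ℚ ℚ.+ Γ) ℚ.* cube (1ℚ ℚ.+ Γ) ℚ.* Γ
    B₃ = K₁ ℚ.* cube (1ℚ ℚ.+ Γ)
    0≤B : 0ℚ ℚ.≤ B₃ ℚ.+ B₂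
    0≤B = +-nonneg 0≤B₃ (*-nonneg 0≤B₂ 0≤Γ)
    bound : ∀ n i → N₀ ≤ i → n ≤ i →
      at (eulerSum (suc (suc n))) i -ᵍ at (P∞ * T∞) i ≼ (B₃ ℚ.+ B₂) ℚ.* pow n
    bound n i i≥ n≤i = subst₂ _≼_ eq (sym (ℚ.*-distribʳ-+ (pow n) B₃ B₂))
      (≼-- (∑e-≼ (q≼σ⁴ i≥) h-eq refl (eulerCoeff-ratio (0<∥1-q^∥² i≥)) n)
        (telescope (λ n → qFac x n *ᵍ ∑ᵍ n (lambert x)) 0≤B₂ (qFac∑h-step (q≼σ⁴ i≥) h-eq) n≤i))
      where
      x = at q i
      h-eq = lambert-eq (0<∥1-q^∥² i≥)
      PH : ℕ → 𝔾
      PH n = qFac x n *ᵍ ∑ᵍ n (lambert x)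
      partial = ∑ᵍ (suc (suc n)) λ k → (k C 2) ·ᵍ eulerCoeff x k
      eq : (partial -ᵍ PH n) -ᵍ (PH i -ᵍ PH n) ≡ at (eulerSum (suc (suc n))) i -ᵍ at (P∞ * T∞) i
      eq = trans
        (solveᵍ 3 (λ s a b → (s ⊖ a) ⊖ (b ⊖ a) ≔ s ⊖ b)
          refl partial (PH n) (PH i))
        (sym (cong₂ _-ᵍ_ (at-eulerSum (suc (suc n)) i)
          (cong₂ _*ᵍ_ (at-qFac q i i) (at-lambert i i))))

theorem2p5 : (q : ℂ) → 0<∣ q ∣ → (∣q∣<1 : ∣ q ∣< 1ᵣ) →
    ((n : ℕ) → 1 ≤ n →
    ∑[ k < suc n ] ((k C 2) · (qBinomial q ∣q∣<1 n k * (- 1#) ^ k * q ^ (k C 2)))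
    ≈ ⟨ q ⨾ q ⟩ (n ∸ 1)
    * ∑[ k < n ∸ 1 ] (q ^ suc k / (1# - q ^ suc k) [ 0<∣1-q^1+k∣ q k ∣q∣<1 ]))
    × (∃[ S ] ∃[ P ] ∃[ T ]
    (∑∞ (λ k → (k C 2) · ((- 1#) ^ k * q ^ (k C 2) / ⟨ q ⨾ q ⟩ k [ 0<∣⟨q⨾q⟩∣ q k ∣q∣<1 ])) ≡ S)
    × (⟨ q ⨾ q ⟩∞≡ P)
    × (∑∞ (λ k → q ^ suc k / (1# - q ^ suc k) [ 0<∣1-q^1+k∣ q k ∣q∣<1 ]) ≡ T)
    × (S ≈ P * T))
theorem2p5 q _ ∣q∣<1 =
  (λ { (suc n) _ → finite-identity q ∣q∣<1 n }) ,
  -- The sum `S` is taken to be the product itself, so the last claim is reflexivity.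
  P∞ q ∣q∣<1 * T∞ q ∣q∣<1 , P∞ q ∣q∣<1 , T∞ q ∣q∣<1 ,
  infinite-sum q ∣q∣<1 , P∞-limit q ∣q∣<1 , T∞-limit q ∣q∣<1 ,
  ≈-refl (P∞ q ∣q∣<1 * T∞ q ∣q∣<1)
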